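{- Let $G$ be a graph, let $P\subseteq V(G)$, let $r$ be a positive integer, and let $G'$ be the graph obtained by the $r$-neighborhood cliquification on $(G,P)$. Given a tree decomposition $\mathcal{T}$ and a layering $(V_1,V_2,\ldots)$ of $G$ witnessing layered treewidth $k$, it is possible to compute, in time $\mathcal{O}(|\mathcal{T}|\cdot(|V(G)|+|E(G)|))$, a tree decomposition $\mathcal{T}'$ of $G'$ with $|\mathcal{T}'|=|\mathcal{T}|$ and a layering of $G'$ witnessing layered tree-independence number $4rk$. In addition, if $r=1$ and $P$ is an independent set in $G$, the same conclusion holds even if $\mathcal{T}$ and $(V_1,V_2,\ldots)$ (only) witness layered tree-independence number $k$ of $G$.
   Context: All graphs are finite and simple; $\alpha$ denotes the independence number. For $r\ge 0$, $N_G^r[v]$ is the set of vertices at distance at most $r$ from $v$ in $G$ (so it includes $v$). The $r$-neighborhood cliquification on $(G,P)$ yields the graph $H$ with $V(H)=V(G)$ where distinct $u,v$ are adjacent in $H$ iff $uv\in E(G)$ or there exists $p\in P$ with $\{u,v\}\subseteq N_G^r[p]$. A tree decomposition of $G$ is a pair $\mathcal{T}=(T,\{X_t\}_{t\in V(T)})$ with $T$ a tree and bags $X_t\subseteq V(G)$ such that every vertex is in some bag, both endpoints of every edge lie in a common bag, and for each $u\in V(G)$ the nodes $t$ with $u\in X_t$ induce a connected subgraph of $T$; $|\mathcal{T}|=|V(T)|$. A layering of $G$ is an ordered partition $(V_1,V_2,\ldots)$ of $V(G)$ (parts may be empty, all but finitely many are) such that for each edge $uv$ with $u\in V_i$, $v\in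 V_j$ we have $|i-j|\le 1$. A tree decomposition $(T,\{X_t\})$ and a layering $(V_1,V_2,\ldots)$ of a graph witness layered treewidth (resp. layered tree-independence number) $\ell$ if $|X_t\cap V_i|\le\ell$ (resp. $\alpha(G[X_t\cap V_i])\le\ell$) for every bag $X_t$ and layer $V_i$. -}

module Defs where

open import Data.Bool.Base using (if_then_else_)
open import Data.Fin.Base using (Fin; toℕ)
import Data.Fin.Properties as Fin
open import Data.Fin.Subset using (Subset; inside; outside; _∈_; _⊆_; _∩_; ∣_∣)
open import Data.Fin.Subset.Properties using (_∈?_; _⊆?_)
open import Data.List.Base using (List; []; _∷_; _++_; _∷ʳ_; map; filter; length; allFin; cartesianProduct)
open import Data.List.Extrema.Nat using (max)
open import Data.List.Relation.Unary.Linked using (Linked)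
open import Data.List.Relation.Unary.Unique.Propositional using (Unique)
open import Data.Nat.Base using (ℕ; zero; suc; _+_; _∸_; _/_; _≤_; _<_; s≤s; s≤s⁻¹; ∣_-_∣)
open import Data.Nat.Properties using (_≟_; anyUpTo?)
open import Data.Product using (Σ; ∃; ∃!; _×_; _,_; proj₁; proj₂)
open import Data.Sum.Base using (_⊎_; inj₁; inj₂)
open import Data.Vec.Base using ([]; _∷_)
open import Level using (0ℓ)
open import Relation.Binary.Core using (Rel)
open import Relation.Binary.Construct.Closure.ReflexiveTransitive using (Star)
open import Relation.Binary.Definitions using (Decidable; Symmetric)
open import Relation.Binary.PropositionalEquality using (_≡_; _≢_; refl; ≢-sym)
open import Relation.Nullary using (¬_; Dec; does)
open import Relation.Nullary.Decidable using (map′; _×-dec_; _⊎-dec_; _→-dec_; ¬?)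
open import Relation.Unary using (Pred)

------------------------------------------------------------------------
-- Graphs

record Graph (n : ℕ) : Set₁ where
  field
    Adj     : Rel (Fin n) 0ℓ
    adj?    : Decidable Adj
    adj-sym : Symmetric Adj
    irrefl  : ∀ {v} → ¬ Adj v v

open Graph public

∣E_∣ : ∀ {n} → Graph n → ℕ
∣E_∣ {n} G =
  length (filter (λ e → (proj₁ e Fin.<? proj₂ e) ×-dec adj? G (proj₁ e) (proj₂ e))
                 (cartesianProduct (allFin n) (allFin n)))

Independent : ∀ {n} → Graph n → Subset n → Set
Independent G S = ∀ u v → u ∈ S → v ∈ S → ¬ Adj G u v

independent? : ∀ {n} (G : Graph n) (S : Subset n) → Dec (Independent G S)
independent? G S =
  Fin.all? λ u → Fin.all? λ v → (u ∈? S) →-dec ((v ∈? S) →-dec ¬? (adj? G u v))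

subsets : ∀ n → List (Subset n)
subsets zero    = [] ∷ []
subsets (suc n) = map (outside ∷_) (subsets n) ++ map (inside ∷_) (subsets n)

-- α G [ S ] is the independence number of the induced subgraph G[S], whose
-- independent sets are the independent sets of G that are contained in S.
α_[_] : ∀ {n} → Graph n → Subset n → ℕ
α_[_] {n} G S =
  max 0 (map ∣_∣ (filter (λ I → (I ⊆? S) ×-dec independent? G I) (subsets n)))

Walk : ∀ {n} → Graph n → ℕ → Rel (Fin n) 0ℓ
Walk G zero    u v = u ≡ v
Walk G (suc k) u v = ∃ λ w → Adj G u w × Walk G k w v

walk? : ∀ {n} (G : Graph n) k → Decidable (Walk G k)
walk? G zero    u v = u Fin.≟ v
walk? G (suc k) u v = Fin.any? λ w → adj? G u w ×-dec walk? G k w v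

-- u ∈N[ G , r , p ] says that u is at distance at most r from p: a shortest
-- walk between them exists and has length at most r.
_∈N[_,_,_] : ∀ {n} → Fin n → Graph n → ℕ → Fin n → Set
u ∈N[ G , r , p ] = ∃ λ k → k ≤ r × Walk G k p u

inN? : ∀ {n} (G : Graph n) r p u → Dec (u ∈N[ G , r , p ])
inN? G r p u =
  map′ (λ (k , k<1+r , w) → k , s≤s⁻¹ k<1+r , w)
       (λ (k , k≤r , w) → k , s≤s k≤r , w)
       (anyUpTo? (λ k → walk? G k p u) (suc r))

cliquification : ∀ {n} → Graph n → Subset n → ℕ → Graph n
cliquification G P r = record
  { Adj     = λ u v → u ≢ v ×
                (Adj G u v ⊎ ∃ λ p → p ∈ P × u ∈N[ G , r , p ] × v ∈N[ G , r , p ])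
  ; adj?    = λ u v → ¬? (u Fin.≟ v) ×-dec
                (adj? G u v ⊎-dec
                 Fin.any? λ p → (p ∈? P) ×-dec (inN? G r p u ×-dec inN? G r p v))
  ; adj-sym = λ where
      (u≢v , inj₁ uv)                → ≢-sym u≢v , inj₁ (adj-sym G uv)
      (u≢v , inj₂ (p , p∈P , u∈ , v∈)) → ≢-sym u≢v , inj₂ (p , p∈P , v∈ , u∈)
  ; irrefl  = λ (v≢v , _) → v≢v refl
  }

------------------------------------------------------------------------
-- Trees, tree decompositions and layerings

Connected : ∀ {n} → Graph n → Set
Connected G = ∀ s t → Star (Adj G) s t

InducesConnected : ∀ {n} → Graph n → Pred (Fin n) 0ℓ → Set
InducesConnected G S =
  ∀ s t → S s → S t → Star (λ a b → S a × S b × Adj G a b) s t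

-- v ∷ vs lists the vertices of a cycle in cyclic order.
IsCycle : ∀ {n} → Graph n → Fin n → List (Fin n) → Set
IsCycle G v vs = 2 ≤ length vs × Unique (v ∷ vs) × Linked (Adj G) (v ∷ vs ∷ʳ v)

record IsTree {m} (T : Graph m) : Set where
  field
    nonEmpty  : 0 < m
    connected : Connected T
    acyclic   : ∀ v vs → ¬ IsCycle T v vs

-- The number m of nodes is the size of the decomposition.
record TreeDecomposition {n} (G : Graph n) (m : ℕ) : Set₁ where
  field
    tree       : Graph m
    isTree     : IsTree tree
    bag        : Fin m → Subset n
    vertex-cov : ∀ v → ∃ λ t → v ∈ bag t
    edge-cov   : ∀ u v → Adj G u v → ∃ λ t → u ∈ bag t × v ∈ bag t
    subtree    : ∀ u → InducesConnected tree (λ t → u ∈ bag t)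

open TreeDecomposition public

-- Indices are shifted by one: layer i is V_{i+1}.  Since there are finitely
-- many vertices, all but finitely many layers are automatically empty.
record Layering {n} (G : Graph n) : Set where
  field
    layer     : ℕ → Subset n
    partition : ∀ v → ∃! _≡_ λ i → v ∈ layer i
    close     : ∀ u v i j → Adj G u v → u ∈ layer i → v ∈ layer j → ∣ i - j ∣ ≤ 1

open Layering public

WitnessLayeredTreewidth :
  ∀ {n m} {G : Graph n} → TreeDecomposition G m → Layering G → ℕ → Set
WitnessLayeredTreewidth 𝒯 𝓛 ℓ = ∀ t i → ∣ bag 𝒯 t ∩ layer 𝓛 i ∣ ≤ ℓ

WitnessLayeredTreeIndependence :
  ∀ {n m} {G : Graph n} → TreeDecomposition G m → Layering G → ℕ → Set
WitnessLayeredTreeIndependence {G = G} 𝒯 𝓛 ℓ = ∀ t i → α G [ bag 𝒯 t ∩ layer 𝓛 i ] ≤ ℓ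

------------------------------------------------------------------------
-- Model of computation
--
-- Structured random-access programs over finitely many integer variables and
-- finitely many integer arrays (with indirect addressing).  Every executed
-- assignment and every evaluated test costs one unit; as the expressions are
-- part of the fixed program, this agrees with the number of elementary
-- operations up to a constant factor.  The only growing operation is the
-- successor (there is deliberately no unit-cost addition or multiplication),
-- so within t steps the values exceed the largest value in the input by at
-- most O(t).  Hence all values computed fit into the words of a word RAM, and
-- every running time below is also a word RAM running time.

Var Arr : Set
Var = ℕ
Arr = ℕ

data Expr : Set where
  lit  : ℕ → Expr
  var  : Var → Expr
  read : Arr → Expr → Expr
  inc  : Expr → Expr
  sub  : Expr → Expr → Expr
  quot : Expr → Expr → Expr

infixr 5 _⨾_

data Program : Set where
  skip  : Program
  set   : Var → Expr → Program
  write : Arr → Expr → Expr → Program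
  _⨾_   : Program → Program → Program
  cond  : Expr → Program → Program → Program
  while : Expr → Program → Program

record Memory : Set where
  constructor memory
  field
    vars : Var → ℕ
    arrs : Arr → ℕ → ℕ

open Memory public

quotient : ℕ → ℕ → ℕ
quotient a zero    = 0
quotient a (suc b) = a / suc b

⟦_⟧ : Expr → Memory → ℕ
⟦ lit c ⟧    s = c
⟦ var x ⟧    s = vars s x
⟦ read a e ⟧ s = arrs s a (⟦ e ⟧ s)
⟦ inc e ⟧    s = suc (⟦ e ⟧ s)
⟦ sub e f ⟧  s = ⟦ e ⟧ s ∸ ⟦ f ⟧ s
⟦ quot e f ⟧ s = quotient (⟦ e ⟧ s) (⟦ f ⟧ s)

_[_≔_] : {A : Set} → (ℕ → A) → ℕ → A → (ℕ → A)
(f [ i ≔ x ]) j = if does (j ≟ i) then x else f j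

setVar : Var → ℕ → Memory → Memory
setVar x c s = memory (vars s [ x ≔ c ]) (arrs s)

writeArr : Arr → ℕ → ℕ → Memory → Memory
writeArr a i c s = memory (vars s) (arrs s [ a ≔ arrs s a [ i ≔ c ] ])

-- ⟨ c , s ⟩⇓[ t ] s′ : started in s, the program c halts in s′ after t steps.
-- A test succeeds when its value is nonzero.
data ⟨_,_⟩⇓[_]_ : Program → Memory → ℕ → Memory → Set where
  run-skip  : ∀ {s} → ⟨ skip , s ⟩⇓[ 1 ] s
  run-set   : ∀ {s x e} → ⟨ set x e , s ⟩⇓[ 1 ] setVar x (⟦ e ⟧ s) s
  run-write : ∀ {s a e f} →
              ⟨ write a e f , s ⟩⇓[ 1 ] writeArr a (⟦ e ⟧ s) (⟦ f ⟧ s) s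
  run-seq   : ∀ {s s′ s″ c d t u} →
              ⟨ c , s ⟩⇓[ t ] s′ → ⟨ d , s′ ⟩⇓[ u ] s″ → ⟨ c ⨾ d , s ⟩⇓[ t + u ] s″
  run-then  : ∀ {s s′ e c d t} → ⟦ e ⟧ s ≢ 0 →
              ⟨ c , s ⟩⇓[ t ] s′ → ⟨ cond e c d , s ⟩⇓[ suc t ] s′
  run-else  : ∀ {s s′ e c d t} → ⟦ e ⟧ s ≡ 0 →
              ⟨ d , s ⟩⇓[ t ] s′ → ⟨ cond e c d , s ⟩⇓[ suc t ] s′
  run-stop  : ∀ {s e c} → ⟦ e ⟧ s ≡ 0 → ⟨ while e c , s ⟩⇓[ 1 ] s
  run-loop  : ∀ {s s′ s″ e c t u} → ⟦ e ⟧ s ≢ 0 →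
              ⟨ c , s ⟩⇓[ t ] s′ → ⟨ while e c , s′ ⟩⇓[ u ] s″ →
              ⟨ while e c , s ⟩⇓[ suc (t + u) ] s″

------------------------------------------------------------------------
-- Representation of inputs and outputs in memory

-- The cells start i, …, start (i + 1) ∸ 1 of items list, without repetition
-- and in any order, the elements of F i.
record Lists {m n} (start items : ℕ → ℕ) (F : Fin m → Pred (Fin n) 0ℓ) : Set where
  field
    start-zero : start 0 ≡ 0
    start-mono : ∀ (i : Fin m) → start (toℕ i) ≤ start (suc (toℕ i))
    sound      : ∀ (i : Fin m) j → start (toℕ i) ≤ j → j < start (suc (toℕ i)) →
                 ∃ λ v → items j ≡ toℕ v × F i v
    complete   : ∀ (i : Fin m) v → F i v →
                 ∃ λ j → start (toℕ i) ≤ j × j < start (suc (toℕ i)) × items j ≡ toℕ v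
    no-repeat  : ∀ (i : Fin m) j k →
                 start (toℕ i) ≤ j → j < start (suc (toℕ i)) →
                 start (toℕ i) ≤ k → k < start (suc (toℕ i)) →
                 items j ≡ items k → j ≡ k

record Location : Set where
  field
    treeStart treeItems bagStart bagItems layerOf : Arr

-- The tree is given by adjacency lists, the bags by lists of their vertices,
-- and the layering by the index of the layer of each vertex.
record Stores {n m} {G : Graph n} (loc : Location) (s : Memory)
              (𝒯 : TreeDecomposition G m) (𝓛 : Layering G) : Set where
  open Location loc
  field
    tree-lists  : Lists (arrs s treeStart) (arrs s treeItems) (Adj (tree 𝒯))
    bag-lists   : Lists (arrs s bagStart) (arrs s bagItems) (λ t v → v ∈ bag 𝒯 t)
    layer-index : ∀ v → v ∈ layer 𝓛 (arrs s layerOf (toℕ v))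

inputLocation : Location
inputLocation = record
  { treeStart = 3 ; treeItems = 4 ; bagStart = 5 ; bagItems = 6 ; layerOf = 7 }

-- Nothing is assumed about the memory outside of the listed data.
record Input {n m} (s : Memory) (G : Graph n) (P : Subset n) (r : ℕ)
             (𝒯 : TreeDecomposition G m) (𝓛 : Layering G) : Set where
  field
    vertices      : vars s 0 ≡ n
    nodes         : vars s 1 ≡ m
    radius        : vars s 2 ≡ r
    graph         : Lists (arrs s 0) (arrs s 1) (Adj G)
    members       : ∀ v → v ∈ P → arrs s 2 (toℕ v) ≡ 1
    nonmembers    : ∀ v → ¬ (v ∈ P) → arrs s 2 (toℕ v) ≡ 0
    decomposition : Stores inputLocation s 𝒯 𝓛

-- Started in s, the program halts within the given time and leaves, at the
-- location out, a tree decomposition of H with m nodes and a layering of H that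
-- witness layered tree-independence number ℓ.
Computes : ∀ {n} (prog : Program) (out : Location) (s : Memory) (time : ℕ)
           (H : Graph n) (m ℓ : ℕ) → Set₁
Computes prog out s time H m ℓ =
  Σ (TreeDecomposition H m) λ 𝒯 → Σ (Layering H) λ 𝓛 →
    WitnessLayeredTreeIndependence 𝒯 𝓛 ℓ ×
    ∃ λ s′ → ∃ λ t → ⟨ prog , s ⟩⇓[ t ] s′ × t ≤ time × Stores out s′ 𝒯 𝓛

{-# OPTIONS --safe #-}

-- The new bag X′ consists of X and of all vertices v such that a walk of length
-- at most r from a vertex of P to v meets X; a new layer is the union of 2r
-- consecutive layers.  Let I be an independent set of G′ inside a new bag and a
-- new layer.  Send v ∈ I to itself if v ∈ X, and otherwise to a vertex u ∈ X on
-- such a walk.  If v and w are both sent to u, then the centre nearer to u has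
-- both of them in its ball, so this map is injective.  It changes the layer by at
-- most r, so its image lies in 4r layers, in each of which X has at most k
-- vertices.  If r = 1 and P is independent, then vertices outside X are sent to
-- neighbours in P, and the image is independent in G.
--
-- A new bag is found by one breadth-first search from P in which each vertex also
-- records whether it was reached by a walk meeting X, so that no vertex is queued
-- more than twice.

module Submission where

open import Defs
open import Level using (0ℓ)
open import Function.Base using (_∘_; id)
open import Data.Bool.Base using (Bool; true; false; if_then_else_; _∨_)
import Data.Bool.Properties as Bool
open import Data.Nat.Base
open import Data.Nat.Properties as ℕ
open import Data.Nat.DivMod
open import Data.Nat.Divisibility using (∣-refl)
open import Data.Nat.Tactic.RingSolver using (solve-∀)
open import Data.Product using (Σ; ∃; _×_; _,_; proj₁; proj₂)
open import Data.Sum.Base as Sum using (_⊎_; inj₁; inj₂)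
open import Data.Fin.Base as Fin using (Fin; zero; suc; toℕ)
open import Data.Fin.Patterns using (0F; 1F; 2F; 3F; 4F; 5F; 6F; 7F)
import Data.Fin.Properties as Fin
open import Data.Fin.Subset using (Subset; inside; outside; _∈_; _⊆_; _∩_; ∣_∣) renaming (_-_ to _∖_)
open import Data.Fin.Subset.Properties
open import Data.List.Base using (List; []; _∷_; _++_; length; map; filter; tabulate; allFin; cartesianProduct)
open import Data.List.Properties using (length-map; length-tabulate)
open import Data.List.Extrema.Nat using (max≤v⁺; xs≤max)
open import Data.List.Membership.DecPropositional using () renaming (_∈?_ to mem?)
open import Data.List.Membership.Propositional using () renaming (_∈_ to _∈ˡ_)
open import Data.List.Membership.Propositional.Properties
open import Data.List.Relation.Unary.All as All using (All; []; _∷_)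
import Data.List.Relation.Unary.All.Properties as All
open import Data.List.Relation.Unary.AllPairs using ([]; _∷_)
open import Data.List.Relation.Unary.Any using (here)
open import Data.List.Relation.Unary.Unique.Propositional using (Unique)
import Data.List.Relation.Unary.Unique.Propositional.Properties as Unique
open import Data.Vec.Base as Vec using ([]; _∷_; here; there)
open import Data.Vec.Properties using ([]=⇒lookup; lookup⇒[]=; lookup∘tabulate)
open import Relation.Binary.Construct.Closure.ReflexiveTransitive using (Star; _◅◅_; gmap; reverse)
open import Relation.Binary.Definitions using (tri<; tri≈; tri>)
open import Relation.Binary.PropositionalEquality hiding (J)
open import Relation.Nullary using (¬_; Dec; yes; no; does; contradiction)
open import Relation.Nullary.Decidable using (_×-dec_; _⊎-dec_; ¬?; dec-true; True; toWitness)
open import Relation.Unary as Unary using (Pred)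
open import Algebra.Properties.CommutativeMonoid.Sum +-0-commutativeMonoid
  using (sum; ∑-comm; ∑-distrib-+; sum-cong-≗)

-- Counting

-- The time bound allows a constant number of traversals of `G` per bag, so the balls around the
-- members of `P` cannot be explored one by one, nor can a factor `r` be spent. Asking for short
-- walks that meet `X` requires a single bit of memory per walk, and a bit that only switches on
-- fits into one traversal. The same choice places the meeting point between the centre and `v`,
-- hence within distance `r` of `v`; if every ball that meets `X` were added as a whole, the
-- distance could reach `2r`.
--
-- Layers are merged `2r` at a time because the ends of an edge of `G′` may share a ball, and then
-- their layers differ by up to `2r`. Widening such a block by the displacement `r` on both sides
-- gives the factor `4r`.
--
-- The tree itself is kept. A vertex `v` that enters a bag through a meeting point `u` also enters
-- every bag that contains a vertex of the walk from `u` to `v`, and these bags lead through the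
-- tree to a bag that held `v` from the start.

private
  variable
    n : ℕ
    A : Set

does⇒ : ∀ {P : Set} (P? : Dec P) → does P? ≡ true → P
does⇒ (yes p) _ = p

subsetOf : {F : Pred (Fin n) 0ℓ} → Unary.Decidable F → Subset n
subsetOf F? = Vec.tabulate (does ∘ F?)

module _ {F : Pred (Fin n) 0ℓ} (F? : Unary.Decidable F) {v : Fin n} where

  ∈-subsetOf⁺ : F v → v ∈ subsetOf F?
  ∈-subsetOf⁺ fv = lookup⇒[]= v _ (trans (lookup∘tabulate _ v) (dec-true (F? v) fv))

  ∈-subsetOf⁻ : v ∈ subsetOf F? → F v
  ∈-subsetOf⁻ v∈ = does⇒ (F? v) (trans (sym (lookup∘tabulate _ v)) ([]=⇒lookup v∈))

unique⇒length≤∣∣ : ∀ (S : Subset n) {xs} → Unique xs → All (_∈ S) xs → length xs ≤ ∣ S ∣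
unique⇒length≤∣∣ S []       []       = z≤n
unique⇒length≤∣∣ S (x∉ ∷ u) (x∈ ∷ a) = ≤-trans
  (s≤s (unique⇒length≤∣∣ (S ∖ _) u
    (All.zipWith (λ (x≢y , y∈) → x∈p∧x≢y⇒x∈p-y y∈ (≢-sym x≢y)) (x∉ , a))))
  (x∈p⇒∣p-x∣<∣p∣ x∈)

elements : Subset n → List (Fin n)
elements []            = []
elements (inside  ∷ S) = zero ∷ map suc (elements S)
elements (outside ∷ S) = map suc (elements S)

length-elements : ∀ (S : Subset n) → length (elements S) ≡ ∣ S ∣
length-elements []            = refl
length-elements (inside  ∷ S) = cong suc (trans (length-map suc (elements S)) (length-elements S))
length-elements (outside ∷ S) = trans (length-map suc (elements S)) (length-elements S)

elements-⊆ : ∀ (S : Subset n) → All (_∈ S) (elements S)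
elements-⊆ []            = []
elements-⊆ (inside  ∷ S) = here ∷ All.map⁺ (All.map there (elements-⊆ S))
elements-⊆ (outside ∷ S) = All.map⁺ (All.map there (elements-⊆ S))

elements-unique : ∀ (S : Subset n) → Unique (elements S)
elements-unique []            = []
elements-unique (inside  ∷ S) =
  All.map⁺ (All.universal (λ _ ()) (elements S)) ∷ Unique.map⁺ Fin.suc-injective (elements-unique S)
elements-unique (outside ∷ S) = Unique.map⁺ Fin.suc-injective (elements-unique S)

map-unique : ∀ {B : Set} {P : Pred A 0ℓ} {f : A → B} →
             (∀ {x y} → P x → P y → f x ≡ f y → x ≡ y) →
             ∀ {xs} → Unique xs → All P xs → Unique (map f xs)
map-unique inj []       []       = []
map-unique inj (x∉ ∷ u) (px ∷ a) =
  All.map⁺ (All.zipWith (λ (x≢y , py) fx≡fy → x≢y (inj px py fx≡fy)) (x∉ , a)) ∷ map-unique inj u a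

length-filter-∁ : ∀ {P : Pred A 0ℓ} (P? : Unary.Decidable P) xs →
                  length xs ≡ length (filter P? xs) + length (filter (¬? ∘ P?) xs)
length-filter-∁ P? []       = refl
length-filter-∁ P? (x ∷ xs) with P? x
... | yes _ = cong suc (length-filter-∁ P? xs)
... | no  _ = trans (cong suc (length-filter-∁ P? xs)) (sym (+-suc _ _))

-- Pigeonhole, peeling off the class of the largest key. The bound is asked of duplicate-free lists
-- within one class, so a caller may argue about one layer at a time.
length-by-fibres : ∀ {P : Pred A 0ℓ} (key : A → ℕ) {k} →
  (∀ j {ys} → Unique ys → All (λ y → P y × key y ≡ j) ys → length ys ≤ k) →
  ∀ N {xs} → Unique xs → All (λ x → P x × key x < N) xs → length xs ≤ N * k
length-by-fibres key fib zero    []  []             = z≤n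
length-by-fibres key fib zero    _   ((_ , ()) ∷ _)
length-by-fibres key {k} fib (suc N) {xs} u a = begin
  length xs                                    ≡⟨ length-filter-∁ at? xs ⟩
  length (filter at? xs) + length (filter (¬? ∘ at?) xs)
    ≤⟨ +-mono-≤
        (fib N (Unique.filter⁺ at? u)
          (All.zipWith (λ ((p , _) , eq) → p , eq) (All.filter⁺ at? a , All.all-filter at? xs)))
        (length-by-fibres key fib N (Unique.filter⁺ (¬? ∘ at?) u)
          (All.zipWith (λ ((p , lt) , ne) → p , ≤∧≢⇒< (s≤s⁻¹ lt) ne)
            (All.filter⁺ (¬? ∘ at?) a , All.all-filter (¬? ∘ at?) xs))) ⟩
  k + N * k                                    ∎
  where
  open ≤-Reasoning
  at? = λ x → key x ℕ.≟ N

∈-subsets : ∀ (S : Subset n) → S ∈ˡ subsets n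
∈-subsets []            = here refl
∈-subsets (outside ∷ S) = ∈-++⁺ˡ (∈-map⁺ _ (∈-subsets S))
∈-subsets (inside  ∷ S) = ∈-++⁺ʳ _ (∈-map⁺ _ (∈-subsets S))

module _ (G : Graph n) (S : Subset n) where

  -- Together with `α-upper` this is the universal property of the maximum; afterwards the
  -- enumeration inside `α_[_]` is never opened again.
  α-least : ∀ {ℓ} → (∀ I → I ⊆ S → Independent G I → ∣ I ∣ ≤ ℓ) → α G [ S ] ≤ ℓ
  α-least bound = max≤v⁺ z≤n (All.map⁺ (All.tabulate λ I∈ →
    let _ , I⊆S , ind = ∈-filter⁻ (λ I → (I ⊆? S) ×-dec independent? G I) {xs = subsets n} I∈
    in bound _ I⊆S ind))

  α-upper : ∀ I → I ⊆ S → Independent G I → ∣ I ∣ ≤ α G [ S ]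
  α-upper I I⊆S ind = All.lookup (xs≤max 0 _)
    (∈-map⁺ ∣_∣ (∈-filter⁺ (λ I → (I ⊆? S) ×-dec independent? G I) (∈-subsets I) (I⊆S , ind)))

-- Degree sums and the number of edges.

indicator : ∀ {P : Set} → Dec P → ℕ
indicator P? = if does P? then 1 else 0

∣subsetOf∣ : {F : Pred (Fin n) 0ℓ} (F? : Unary.Decidable F) →
             ∣ subsetOf F? ∣ ≡ sum (indicator ∘ F?)
∣subsetOf∣ {zero}  F? = refl
∣subsetOf∣ {suc n} F? with does (F? zero)
... | true  = cong suc (∣subsetOf∣ (F? ∘ suc))
... | false = ∣subsetOf∣ (F? ∘ suc)

length-filter-++ : ∀ {P : Pred A 0ℓ} (P? : Unary.Decidable P) xs ys →
                   length (filter P? (xs ++ ys)) ≡ length (filter P? xs) + length (filter P? ys)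
length-filter-++ P? []       ys = refl
length-filter-++ P? (x ∷ xs) ys with does (P? x)
... | true  = cong suc (length-filter-++ P? xs ys)
... | false = length-filter-++ P? xs ys

length-filter-map-tabulate : ∀ {B : Set} {P : Pred B 0ℓ} (P? : Unary.Decidable P)
  (f : Fin n → A) (g : A → B) →
  length (filter P? (map g (tabulate f))) ≡ sum (λ i → indicator (P? (g (f i))))
length-filter-map-tabulate {zero}  P? f g = refl
length-filter-map-tabulate {suc n} P? f g with does (P? (g (f zero)))
... | true  = cong suc (length-filter-map-tabulate P? (f ∘ suc) g)
... | false = length-filter-map-tabulate P? (f ∘ suc) g

length-filter-cartesianProduct : ∀ {k n} {P : Pred (A × Fin n) 0ℓ} (P? : Unary.Decidable P)
  (f : Fin k → A) →
  length (filter P? (cartesianProduct (tabulate f) (allFin n))) ≡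
  sum (λ i → sum (λ j → indicator (P? (f i , j))))
length-filter-cartesianProduct {k = zero}  P? f = refl
length-filter-cartesianProduct {k = suc k} P? f = trans
  (length-filter-++ P? (map (f zero ,_) (allFin _)) _)
  (cong₂ _+_ (length-filter-map-tabulate P? id (f zero ,_))
             (length-filter-cartesianProduct P? (f ∘ suc)))

sum-mono-≤ : ∀ {f g : Fin n → ℕ} → (∀ i → f i ≤ g i) → sum f ≤ sum g
sum-mono-≤ {zero}  f≤g = z≤n
sum-mono-≤ {suc n} f≤g = +-mono-≤ (f≤g zero) (sum-mono-≤ (f≤g ∘ suc))

indicator-⊎ : ∀ {P Q R : Set} (P? : Dec P) (Q? : Dec Q) (R? : Dec R) → (P → Q ⊎ R) →
              indicator P? ≤ indicator Q? + indicator R?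
indicator-⊎ (no _)  _       _       _   = z≤n
indicator-⊎ (yes p) (yes _) _       _   = s≤s z≤n
indicator-⊎ (yes p) (no _)  (yes _) _   = s≤s z≤n
indicator-⊎ (yes p) (no ¬q) (no ¬r) p⇒ with p⇒ p
... | inj₁ q = contradiction q ¬q
... | inj₂ r = contradiction r ¬r

neighbours : Graph n → Fin n → Subset n
neighbours G u = subsetOf (adj? G u)

-- `∣E_∣` counts increasing pairs only. Each ordered adjacent pair is charged to its increasing
-- orientation, and exchanging the two sums shows that both orientations contribute `∣E G ∣`.
handshake : ∀ (G : Graph n) → sum (λ u → ∣ neighbours G u ∣) ≤ 2 * ∣E G ∣
handshake {n} G = begin
  sum (λ u → ∣ neighbours G u ∣)                ≡⟨ sum-cong-≗ (λ u → ∣subsetOf∣ (adj? G u)) ⟩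
  sum (λ u → sum (λ v → indicator (adj? G u v)))
    ≤⟨ sum-mono-≤ (λ u → sum-mono-≤ (λ v →
         indicator-⊎ (adj? G u v) (up? (u , v)) (up? (v , u)) (orient u v))) ⟩
  sum (λ u → sum (λ v → e u v + e v u))
    ≡⟨ sum-cong-≗ (λ u → ∑-distrib-+ (e u) (λ v → e v u)) ⟩
  sum (λ u → sum (e u) + sum (λ v → e v u))
    ≡⟨ ∑-distrib-+ (λ u → sum (e u)) (λ u → sum (λ v → e v u)) ⟩
  sum (λ u → sum (e u)) + sum (λ u → sum (λ v → e v u))
    ≡⟨ cong (sum (λ u → sum (e u)) +_) (∑-comm (λ u v → e v u)) ⟩
  sum (λ u → sum (e u)) + sum (λ u → sum (e u))
    ≡⟨ cong₂ _+_ edges (trans (+-identityʳ _) edges) ⟨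
  2 * ∣E G ∣                                    ∎
  where
  open ≤-Reasoning
  up? : (p : Fin n × Fin n) → Dec (proj₁ p Fin.< proj₂ p × Adj G (proj₁ p) (proj₂ p))
  up? (u , v) = (u Fin.<? v) ×-dec adj? G u v
  e : Fin n → Fin n → ℕ
  e u v = indicator (up? (u , v))
  orient : ∀ u v → Adj G u v → (u Fin.< v × Adj G u v) ⊎ (v Fin.< u × Adj G v u)
  orient u v uv with Fin.<-cmp u v
  ... | tri< u<v _ _    = inj₁ (u<v , uv)
  ... | tri≈ _ refl _   = contradiction uv (irrefl G)
  ... | tri> _ _ v<u    = inj₂ (v<u , adj-sym G uv)
  edges : ∣E G ∣ ≡ sum (λ u → sum (e u))
  edges = length-filter-cartesianProduct up? id

-- The tree decomposition and the layering of the cliquification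

walk-snoc : ∀ {n} (G : Graph n) k {u v w} → Walk G k u v → Adj G v w → Walk G (suc k) u w
walk-snoc G zero    refl         vw = _ , vw , refl
walk-snoc G (suc k) (x , ux , xv) vw = x , ux , walk-snoc G k xv vw

walk-sym : ∀ {n} (G : Graph n) k {u v} → Walk G k u v → Walk G k v u
walk-sym G zero    refl          = refl
walk-sym G (suc k) (x , ux , xv) = walk-snoc G k (walk-sym G k xv) (adj-sym G ux)

walk-++ : ∀ {n} (G : Graph n) j k {u v w} → Walk G j u v → Walk G k v w → Walk G (j + k) u w
walk-++ G zero    k refl          vw = vw
walk-++ G (suc j) k (x , ux , xv) vw = x , ux , walk-++ G j k xv vw

∣m-n∣≤ : ∀ m n {k} → m ≤ n + k → n ≤ m + k → ∣ m - n ∣ ≤ k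
∣m-n∣≤ m n m≤ n≤ with ∣m-n∣≡[m∸n]∨[n∸m] m n
... | inj₁ eq rewrite eq = m≤n+o⇒m∸n≤o m n m≤
... | inj₂ eq rewrite eq = m≤n+o⇒m∸n≤o n m n≤

≤+∣m-n∣ : ∀ m n {k} → ∣ m - n ∣ ≤ k → m ≤ n + k × n ≤ m + k
≤+∣m-n∣ m n le =
  ≤-trans (m≤n+∣m-n∣ m n) (+-monoʳ-≤ n le) ,
  ≤-trans (m≤n+∣n-m∣ n m) (+-monoʳ-≤ m le)

index : ∀ {n} {G : Graph n} → Layering G → Fin n → ℕ
index 𝓛 v = proj₁ (partition 𝓛 v)

module _ {n} {G : Graph n} (𝓛 : Layering G) where

  ∈-layer-index : ∀ v → v ∈ layer 𝓛 (index 𝓛 v)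
  ∈-layer-index v = proj₁ (proj₂ (partition 𝓛 v))

  index-unique : ∀ {v i} → v ∈ layer 𝓛 i → index 𝓛 v ≡ i
  index-unique {v} = proj₂ (proj₂ (partition 𝓛 v))

  index-walk : ∀ k {u v} → Walk G k u v → ∣ index 𝓛 u - index 𝓛 v ∣ ≤ k
  index-walk zero    {u} refl = ≤-reflexive (∣n-n∣≡0 (index 𝓛 u))
  index-walk (suc k) {u} {v} (x , ux , xv) = ≤-trans
    (∣-∣-triangle (index 𝓛 u) (index 𝓛 x) (index 𝓛 v))
    (+-mono-≤ (close 𝓛 u x _ _ ux (∈-layer-index u) (∈-layer-index x)) (index-walk k xv))

-- For r ≥ 1 this is ⌊ i / 2r ⌋, in a form computable without multiplication.
block : ℕ → ℕ → ℕ
block r i = quotient (i / 2) r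

block-/ : ∀ r .{{_ : NonZero r}} .{{_ : NonZero (2 * r)}} i → block r i ≡ i / (2 * r)
block-/ (suc r) i = m/n/o≡m/[n*o] i 2 (suc r)

module _ (r : ℕ) .{{_ : NonZero r}} where

  private instance
    2r-nonZero : NonZero (2 * r)
    2r-nonZero = m*n≢0 2 r

  block-bounds : ∀ i → block r i * (2 * r) ≤ i × i < block r i * (2 * r) + 2 * r
  block-bounds i rewrite block-/ r i =
    m/n*n≤m i (2 * r) ,
    (begin-strict
      i                                        ≡⟨ m≡m%n+[m/n]*n i (2 * r) ⟩
      i % (2 * r) + i / (2 * r) * (2 * r)      <⟨ +-monoˡ-< _ (m%n<n i (2 * r)) ⟩
      2 * r + i / (2 * r) * (2 * r)            ≡⟨ +-comm (2 * r) _ ⟩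
      i / (2 * r) * (2 * r) + 2 * r            ∎)
    where open ≤-Reasoning

  block-≤ : ∀ i j → i ≤ j + 2 * r → block r i ≤ block r j + 1
  block-≤ i j i≤ = begin
    block r i                     ≡⟨ block-/ r i ⟩
    i / (2 * r)                   ≤⟨ /-monoˡ-≤ (2 * r) i≤ ⟩
    (j + 2 * r) / (2 * r)         ≡⟨ +-distrib-/-∣ʳ j (∣-refl {2 * r}) ⟩
    j / (2 * r) + 2 * r / (2 * r) ≡⟨ cong₂ _+_ (sym (block-/ r j)) (n/n≡1 (2 * r)) ⟩
    block r j + 1                 ∎
    where open ≤-Reasoning

  block-close : ∀ i j → ∣ i - j ∣ ≤ 2 * r → ∣ block r i - block r j ∣ ≤ 1
  block-close i j le = let i≤ , j≤ = ≤+∣m-n∣ i j le in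
    ∣m-n∣≤ (block r i) (block r j) (block-≤ i j i≤) (block-≤ j i j≤)

-- New bags and their anchors.

module Construction {n} (G : Graph n) (P : Subset n) (r : ℕ) where

  G′ : Graph n
  G′ = cliquification G P r

  -- The forms `a < suc r` and `r ∸ a` bound every quantifier by a finite range, which makes
  -- `newBag?` a plain search. `through` and `through⁻` translate to the symmetric condition
  -- `a + b ≤ r`.
  Through : Subset n → Pred (Fin n) 0ℓ
  Through X v = ∃ λ u → u ∈ X × ∃ λ a → a < suc r ×
    (∃ λ p → p ∈ P × Walk G a p u) × v ∈N[ G , r ∸ a , u ]

  NewBag : Subset n → Pred (Fin n) 0ℓ
  NewBag X v = v ∈ X ⊎ Through X v

  newBag? : ∀ X → Unary.Decidable (NewBag X)
  newBag? X v = (v ∈? X) ⊎-dec Fin.any? λ u → (u ∈? X) ×-dec anyUpTo?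
    (λ a → (Fin.any? λ p → (p ∈? P) ×-dec walk? G a p u) ×-dec inN? G (r ∸ a) u v) (suc r)

  through : ∀ {X p u v} a b → p ∈ P → u ∈ X → Walk G a p u → Walk G b u v → a + b ≤ r → Through X v
  through a b p∈ u∈ pu uv a+b≤r =
    _ , u∈ , a , s≤s (m+n≤o⇒m≤o a a+b≤r) , (_ , p∈ , pu) ,
    b , m+n≤o⇒m≤o∸n b (≤-trans (≤-reflexive (+-comm b a)) a+b≤r) , uv

  through⁻ : ∀ {X v} → Through X v →
    ∃ λ p → ∃ λ u → ∃ λ a → ∃ λ b → p ∈ P × u ∈ X × Walk G a p u × Walk G b u v × a + b ≤ r
  through⁻ (u , u∈ , a , s≤s a≤r , (p , p∈ , pu) , b , b≤ , uv) =
    p , u , a , b , p∈ , u∈ , pu , uv ,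
    ≤-trans (+-monoʳ-≤ a b≤) (≤-reflexive (m+[n∸m]≡n a≤r))

  -- An independent set of G′ is mapped injectively to its anchors in X.
  data Anchor (X : Subset n) : Fin n → Fin n → Set where
    self : ∀ {v} → v ∈ X → Anchor X v v
    via  : ∀ {v p u} a b → ¬ (v ∈ X) → p ∈ P → u ∈ X → Walk G a p u → Walk G b u v → a + b ≤ r →
           Anchor X v u

  anchor : ∀ {X v} → NewBag X v → ∃ (Anchor X v)
  anchor (inj₁ v∈X) = _ , self v∈X
  anchor {X} {v} (inj₂ th) with v ∈? X
  ... | yes v∈X = _ , self v∈X
  ... | no  v∉X = let _ , u , a , b , p∈ , u∈ , pu , uv , le = through⁻ th in
    u , via a b v∉X p∈ u∈ pu uv le

  anchor-∈ : ∀ {X v u} → Anchor X v u → u ∈ X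
  anchor-∈ (self v∈)                 = v∈
  anchor-∈ (via _ _ _ _ u∈ _ _ _)    = u∈

  anchor-unique : ∀ {X v w u} → Anchor X v u → Anchor X w u → v ≢ w → Adj G′ v w
  anchor-unique (self _) (self _) v≢w = contradiction refl v≢w
  -- Here `v` is itself the meeting point on the walk to `w`, so the prefix of length `a` puts it in
  -- the ball.
  anchor-unique (self _) (via a b _ p∈ _ pu uw le) v≢w =
    v≢w , inj₂ (_ , p∈ , (a , m+n≤o⇒m≤o a le , pu) , (a + b , le , walk-++ G a b pu uw))
  anchor-unique (via a b _ p∈ _ pu uv le) (self _) v≢w =
    v≢w , inj₂ (_ , p∈ , (a + b , le , walk-++ G a b pu uv) , (a , m+n≤o⇒m≤o a le , pu))
  anchor-unique (via a b _ p∈ _ pu uv le) (via a′ b′ _ p∈′ _ pu′ uw le′) v≢w with ≤-total a a′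
  ... | inj₁ a≤a′ = v≢w , inj₂ (_ , p∈ , (a + b , le , walk-++ G a b pu uv) ,
          (a + b′ , ≤-trans (+-monoˡ-≤ b′ a≤a′) le′ , walk-++ G a b′ pu uw))
  ... | inj₂ a′≤a = v≢w , inj₂ (_ , p∈′ ,
          (a′ + b , ≤-trans (+-monoˡ-≤ b a′≤a) le , walk-++ G a′ b pu′ uv) ,
          (a′ + b′ , le′ , walk-++ G a′ b′ pu′ uw))

  anchor-close : ∀ (𝓛 : Layering G) {X v u} → Anchor X v u → ∣ index 𝓛 u - index 𝓛 v ∣ ≤ r
  anchor-close 𝓛 {v = v} (self _) = ≤-trans (≤-reflexive (∣n-n∣≡0 (index 𝓛 v))) z≤n
  anchor-close 𝓛 (via a b _ _ _ _ uv le) = ≤-trans (index-walk 𝓛 b uv) (m+n≤o⇒n≤o a le)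

  -- Made total by the identity outside the new bag, so that it can be mapped over lists of
  -- vertices.
  choose : Subset n → Fin n → Fin n
  choose X v with newBag? X v
  ... | yes v∈ = proj₁ (anchor v∈)
  ... | no  _  = v

  choose-anchor : ∀ {X v} → NewBag X v → Anchor X v (choose X v)
  choose-anchor {X} {v} v∈ with newBag? X v
  ... | yes v∈′ = proj₂ (anchor v∈′)
  ... | no  v∉  = contradiction v∈ v∉

  -- Connectivity of the new bags in the tree.

  module _ {m} (𝒯 : TreeDecomposition G m) where

    private
      S : Fin n → Pred (Fin m) 0ℓ
      S v t = NewBag (bag 𝒯 t) v

      Path : Fin n → Fin m → Fin m → Set
      Path v = Star (λ s t → S v s × S v t × Adj (tree 𝒯) s t)

      -- If every bag of `u` receives `v`, then a path inside the subtree of `u` is also a path for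
      -- `v`.
      widen : ∀ {u v s t} → (∀ {x} → u ∈ bag 𝒯 x → S v x) →
              u ∈ bag 𝒯 s → u ∈ bag 𝒯 t → Path v s t
      widen {u} {s = s} {t} f u∈s u∈t =
        gmap (λ x → x) (λ (u∈x , u∈y , xy) → f u∈x , f u∈y , xy) (subtree 𝒯 u s t u∈s u∈t)

      -- Every bag meeting the part of the walk between u and v receives v,
      -- so the walk can be followed through the tree.
      along : ∀ {p u v} a b {s t} → p ∈ P → Walk G a p u → Walk G b u v → a + b ≤ r →
              u ∈ bag 𝒯 s → v ∈ bag 𝒯 t → Path v s t
      along a zero    p∈ pu refl le u∈s v∈t = widen inj₁ u∈s v∈t
      along a (suc b) p∈ pu (x , ux , xv) le u∈s v∈t =
        let _ , u∈y , x∈y = edge-cov 𝒯 _ x ux in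
        widen (λ u∈ → inj₂ (through a (suc b) p∈ u∈ pu (x , ux , xv) le)) u∈s u∈y
        ◅◅ along (suc a) b p∈ (walk-snoc G a pu ux) xv
             (≤-trans (≤-reflexive (sym (+-suc a b))) le) x∈y v∈t

      -- Connectivity is shown by leading every node of `v` to an old bag of `v`; two such paths to
      -- the same bag are then glued in `𝒯′`.
      toHome : ∀ {v s t} → S v s → v ∈ bag 𝒯 t → Path v s t
      toHome (inj₁ v∈s) v∈t = widen inj₁ v∈s v∈t
      toHome (inj₂ th)  v∈t = let _ , _ , a , b , p∈ , u∈ , pu , uv , le = through⁻ th in
        along a b p∈ pu uv le u∈ v∈t

    newBag : Fin m → Subset n
    newBag t = subsetOf (newBag? (bag 𝒯 t))

    private
      new⁺ : ∀ t {v} → S v t → v ∈ newBag t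
      new⁺ t = ∈-subsetOf⁺ (newBag? (bag 𝒯 t))

      new⁻ : ∀ t {v} → v ∈ newBag t → S v t
      new⁻ t = ∈-subsetOf⁻ (newBag? (bag 𝒯 t))

    𝒯′ : TreeDecomposition G′ m
    𝒯′ = record
      { tree       = tree 𝒯
      ; isTree     = isTree 𝒯
      ; bag        = newBag
      ; vertex-cov = λ v → let t , v∈ = vertex-cov 𝒯 v in t , new⁺ t (inj₁ v∈)
      ; edge-cov   = cov
      ; subtree    = λ v s t v∈s v∈t →
          let h , v∈h = vertex-cov 𝒯 v in
          gmap (λ x → x) (λ {x} {y} (v∈x , v∈y , xy) → new⁺ x v∈x , new⁺ y v∈y , xy)
            (toHome (new⁻ s v∈s) v∈h ◅◅
             reverse (λ (v∈x , v∈y , xy) → v∈y , v∈x , adj-sym (tree 𝒯) xy)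
               (toHome (new⁻ t v∈t) v∈h))
      }
      where
      cov : ∀ u v → Adj G′ u v → ∃ λ t → u ∈ newBag t × v ∈ newBag t
      cov u v (_ , inj₁ uv) = let t , u∈ , v∈ = edge-cov 𝒯 u v uv in
        t , new⁺ t (inj₁ u∈) , new⁺ t (inj₁ v∈)
      -- Any bag that contains the centre `p` receives its whole ball: the walk meets the bag at its
      -- start, hence the prefix length 0.
      cov u v (_ , inj₂ (p , p∈ , (b , b≤ , pu) , (b′ , b′≤ , pv))) =
        let t , p∈t = vertex-cov 𝒯 p in
        t , new⁺ t (inj₂ (through 0 b p∈ p∈t refl pu b≤)) ,
            new⁺ t (inj₂ (through 0 b′ p∈ p∈t refl pv b′≤))

  -- The new layers and the bound on independent sets.

  module _ .{{_ : NonZero r}} (𝓛 : Layering G) where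

    inBlock? : ∀ i → Unary.Decidable (λ v → block r (index 𝓛 v) ≡ i)
    inBlock? i v = block r (index 𝓛 v) ℕ.≟ i

    -- Two vertices of a ball are joined by two walks of length at most `r` through its centre. An
    -- old edge changes the layer by at most 1, which is within the bound because `r` is nonzero.
    index-G′ : ∀ {u v} → Adj G′ u v → ∣ index 𝓛 u - index 𝓛 v ∣ ≤ 2 * r
    index-G′ {u} {v} (_ , inj₁ uv) = ≤-trans
      (close 𝓛 u v _ _ uv (∈-layer-index 𝓛 u) (∈-layer-index 𝓛 v))
      (≤-trans (>-nonZero⁻¹ r) (m≤m+n r (1 * r)))
    index-G′ {u} {v} (_ , inj₂ (p , _ , (a , a≤ , pu) , (b , b≤ , pv))) = begin
      ∣ index 𝓛 u - index 𝓛 v ∣ ≤⟨ ∣-∣-triangle (index 𝓛 u) (index 𝓛 p) (index 𝓛 v) ⟩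
      ∣ index 𝓛 u - index 𝓛 p ∣ + ∣ index 𝓛 p - index 𝓛 v ∣
        ≤⟨ +-mono-≤ (≤-trans (index-walk 𝓛 a (walk-sym G a pu)) a≤)
                    (≤-trans (index-walk 𝓛 b pv) (≤-trans b≤ (≤-reflexive (sym (+-identityʳ r))))) ⟩
      2 * r ∎
      where open ≤-Reasoning

    𝓛′ : Layering G′
    𝓛′ = record
      { layer     = λ i → subsetOf (inBlock? i)
      ; partition = λ v → block r (index 𝓛 v) ,
          ∈-subsetOf⁺ (inBlock? _) refl , λ {i} v∈ → ∈-subsetOf⁻ (inBlock? i) v∈
      ; close     = λ u v i j uv u∈ v∈ →
          subst₂ (λ i j → ∣ i - j ∣ ≤ 1) (∈-subsetOf⁻ (inBlock? i) u∈) (∈-subsetOf⁻ (inBlock? j) v∈)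
            (block-close r (index 𝓛 u) (index 𝓛 v) (index-G′ uv))
      }

    module _ {m} (𝒯 : TreeDecomposition G m) where

      private
        f : Fin m → Fin n → Fin n
        f t = choose (bag 𝒯 t)

        f-anchor : ∀ {t i I v} → I ⊆ bag (𝒯′ 𝒯) t ∩ layer 𝓛′ i → v ∈ I → Anchor (bag 𝒯 t) v (f t v)
        f-anchor {t} I⊆ v∈ =
          choose-anchor (∈-subsetOf⁻ (newBag? (bag 𝒯 t)) (proj₁ (x∈p∩q⁻ (newBag 𝒯 t) _ (I⊆ v∈))))

        -- The `2r` layers of a block, widened by `r` below and above. In block 0 the lower end is
        -- truncated to 0, which is harmless since `m ≤ r + (m ∸ r)` still holds.
        window : ∀ {i x y} → block r x ≡ i → ∣ y - x ∣ ≤ r →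
                 i * (2 * r) ∸ r ≤ y × y ∸ (i * (2 * r) ∸ r) < 4 * r
        window {x = x} {y} refl near = lo≤y , (begin-strict
          y ∸ lo            <⟨ ≤-reflexive (sym (+-∸-assoc 1 lo≤y)) ⟩
          suc y ∸ lo        ≤⟨ m≤n+o⇒m∸n≤o (suc y) lo suc-y≤ ⟩
          4 * r             ∎)
          where
          open ≤-Reasoning
          lo = block r x * (2 * r) ∸ r
          y≤ = proj₁ (≤+∣m-n∣ y x near)
          x≤ = proj₂ (≤+∣m-n∣ y x near)
          lo≤y = m≤n+o⇒m∸n≤o _ r (≤-trans (proj₁ (block-bounds r x)) (≤-trans x≤ (≤-reflexive (+-comm y r))))
          regroup : ∀ l r → (r + l) + 2 * r + r ≡ l + 4 * r
          regroup = solve-∀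
          suc-y≤ : suc y ≤ lo + 4 * r
          suc-y≤ = begin
            suc y                             ≤⟨ s≤s y≤ ⟩
            suc x + r                         ≤⟨ +-monoˡ-≤ r (proj₂ (block-bounds r x)) ⟩
            block r x * (2 * r) + 2 * r + r   ≤⟨ +-monoˡ-≤ r (+-monoˡ-≤ (2 * r) (m≤n+m∸n _ r)) ⟩
            (r + lo) + 2 * r + r              ≡⟨ regroup lo r ⟩
            lo + 4 * r                        ∎

      -- Vertices are grouped by the layer of their anchor rather than their own: anchors lie in the
      -- old bag, so each group can be measured by the hypothesis on `𝒯` and `𝓛`.
      bound-by-layers : ∀ {k t i I} → I ⊆ bag (𝒯′ 𝒯) t ∩ layer 𝓛′ i →
        (∀ l {ys} → Unique ys → All (λ v → v ∈ I × index 𝓛 (f t v) ≡ l) ys → length ys ≤ k) →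
        ∣ I ∣ ≤ 4 * r * k
      bound-by-layers {k} {t} {i} {I} I⊆ fibre = subst (_≤ 4 * r * k) (length-elements I)
        (length-by-fibres (λ v → index 𝓛 (f t v) ∸ lo)
          (λ j u a → fibre (lo + j) u (All.map (λ ((v∈ , lo≤) , eq) →
            v∈ , trans (sym (m+[n∸m]≡n lo≤)) (cong (lo +_) eq)) a))
          (4 * r) (elements-unique I)
          (All.map (λ {v} v∈ → let lo≤ , <4r = inWindow v∈ in (v∈ , lo≤) , <4r) (elements-⊆ I)))
        where
        lo = i * (2 * r) ∸ r
        inWindow : ∀ {v} → v ∈ I → lo ≤ index 𝓛 (f t v) × index 𝓛 (f t v) ∸ lo < 4 * r
        inWindow {v} v∈ = window
          (∈-subsetOf⁻ (inBlock? i) (proj₂ (x∈p∩q⁻ (newBag 𝒯 t) _ (I⊆ v∈))))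
          (anchor-close 𝓛 (f-anchor {i = i} I⊆ v∈))

      module _ {t i I} (I⊆ : I ⊆ bag (𝒯′ 𝒯) t ∩ layer 𝓛′ i) (ind : Independent G′ I)
               {l ys} (u : Unique ys) (a : All (λ v → v ∈ I × index 𝓛 (f t v) ≡ l) ys) where

        private
          anch : ∀ {v} → v ∈ I → Anchor (bag 𝒯 t) v (f t v)
          anch = f-anchor {i = i} I⊆

        anchors-unique : Unique (map (f t) ys)
        anchors-unique = map-unique inj u (All.map proj₁ a)
          where
          inj : ∀ {v w} → v ∈ I → w ∈ I → f t v ≡ f t w → v ≡ w
          inj {v} {w} v∈ w∈ eq with v Fin.≟ w
          ... | yes v≡w = v≡w
          ... | no  v≢w = contradiction
            (anchor-unique (anch v∈) (subst (Anchor _ w) (sym eq) (anch w∈)) v≢w) (ind v w v∈ w∈)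

        anchors-⊆ : All (_∈ bag 𝒯 t ∩ layer 𝓛 l) (map (f t) ys)
        anchors-⊆ = All.map⁺ (All.map (λ {v} (v∈ , eq) →
          x∈p∩q⁺ (anchor-∈ (anch v∈) , subst (λ l → f t v ∈ layer 𝓛 l) eq (∈-layer-index 𝓛 (f t v)))) a)

        fibre-≤-∣∣ : length ys ≤ ∣ bag 𝒯 t ∩ layer 𝓛 l ∣
        fibre-≤-∣∣ = subst (_≤ _) (length-map (f t) ys)
          (unique⇒length≤∣∣ _ anchors-unique anchors-⊆)

        -- Injectivity alone bounds a cardinality; to compare with `α` the anchors must also be
        -- independent in `G`. They are collected in the subset `J` because `α_[_]` ranges over
        -- subsets.
        fibre-≤-α : (∀ {v w x y} → v ∈ I → w ∈ I → Anchor (bag 𝒯 t) v x → Anchor (bag 𝒯 t) w y →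
                     ¬ Adj G x y) →
                    length ys ≤ α G [ bag 𝒯 t ∩ layer 𝓛 l ]
        fibre-≤-α anchorsIndependent = begin
          length ys              ≡⟨ length-map (f t) ys ⟨
          length (map (f t) ys)  ≤⟨ unique⇒length≤∣∣ J anchors-unique
                                      (All.tabulate (∈-subsetOf⁺ J?)) ⟩
          ∣ J ∣                  ≤⟨ α-upper G _ J
                                      (λ x∈ → All.lookup anchors-⊆ (∈-subsetOf⁻ J? x∈)) J-independent ⟩
          α G [ bag 𝒯 t ∩ layer 𝓛 l ] ∎
          where
          open ≤-Reasoning
          J? = λ v → mem? Fin._≟_ v (map (f t) ys)
          J = subsetOf J?
          J-independent : Independent G J
          J-independent x y x∈ y∈ xy =
            let v , v∈ys , x≡ = ∈-map⁻ (f t) (∈-subsetOf⁻ J? x∈)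
                w , w∈ys , y≡ = ∈-map⁻ (f t) (∈-subsetOf⁻ J? y∈)
                v∈ = proj₁ (All.lookup a v∈ys)
                w∈ = proj₁ (All.lookup a w∈ys)
            in anchorsIndependent v∈ w∈ (anch v∈) (anch w∈) (subst₂ (Adj G) x≡ y≡ xy)

      treewidth-witness : ∀ {k} → WitnessLayeredTreewidth 𝒯 𝓛 k →
                          WitnessLayeredTreeIndependence (𝒯′ 𝒯) 𝓛′ (4 * r * k)
      treewidth-witness w t i = α-least G′ _ λ I I⊆ ind →
        bound-by-layers {t = t} {i} I⊆ λ l u a → ≤-trans (fibre-≤-∣∣ {i = i} I⊆ ind u a) (w t l)

-- Radius 1 with independent centres.

module _ {n} {G : Graph n} {P : Subset n} (P-ind : Independent G P) where
  open Construction G P 1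

  -- A walk of length at most 1 that ends outside `X` can meet `X` only at its start, so the anchor
  -- is the centre.
  via-member : ∀ {X v u} → ¬ (v ∈ X) → Anchor X v u → u ∈ P × Adj G u v
  via-member v∉ (self v∈)                               = contradiction v∈ v∉
  via-member v∉ (via a zero _ p∈ u∈ pu refl le)         = contradiction u∈ v∉
  via-member v∉ (via zero (suc zero) _ p∈ u∈ refl (_ , uv , refl) le) = p∈ , uv
  via-member v∉ (via zero (suc (suc b)) _ _ _ _ _ (s≤s ()))
  via-member v∉ (via (suc zero) (suc b) _ _ _ _ _ (s≤s ()))
  via-member v∉ (via (suc (suc a)) (suc b) _ _ _ _ _ (s≤s ()))

  -- If exactly one anchor is a centre, the other vertex is adjacent to that centre, so both
  -- vertices lie in its ball. Two centres are never adjacent: this is where the independence of `P`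
  -- enters.
  anchors-independent : ∀ {X v w x y} → Anchor X v x → Anchor X w y → Adj G x y → Adj G′ v w
  anchors-independent (self v∈) (self w∈) vw = (λ { refl → irrefl G vw }) , inj₁ vw
  anchors-independent (self v∈) w@(via _ _ w∉ _ _ _ _ _) vy =
    let y∈ , yw = via-member w∉ w in
    (λ { refl → w∉ v∈ }) , inj₂ (_ , y∈ , (1 , s≤s z≤n , _ , adj-sym G vy , refl) , (1 , s≤s z≤n , _ , yw , refl))
  anchors-independent v@(via _ _ v∉ _ _ _ _ _) (self w∈) xw =
    let x∈ , xv = via-member v∉ v in
    (λ { refl → v∉ w∈ }) , inj₂ (_ , x∈ , (1 , s≤s z≤n , _ , xv , refl) , (1 , s≤s z≤n , _ , xw , refl))
  anchors-independent v@(via _ _ v∉ _ _ _ _ _) w@(via _ _ w∉ _ _ _ _ _) xy =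
    contradiction xy (P-ind _ _ (proj₁ (via-member v∉ v)) (proj₁ (via-member w∉ w)))

  tree-independence-witness : ∀ {m} (𝒯 : TreeDecomposition G m) (𝓛 : Layering G) {k} →
    WitnessLayeredTreeIndependence 𝒯 𝓛 k → WitnessLayeredTreeIndependence (𝒯′ 𝒯) (𝓛′ 𝓛) (4 * 1 * k)
  tree-independence-witness 𝒯 𝓛 w t i = α-least G′ _ λ I I⊆ ind →
    bound-by-layers 𝓛 𝒯 {t = t} {i} I⊆ λ l u a →
      ≤-trans (fibre-≤-α 𝓛 𝒯 {i = i} I⊆ ind u a
                (λ v∈ w∈ va wa xy → ind _ _ v∈ w∈ (anchors-independent va wa xy)))
              (w t l)

-- Program logic

-- A Boolean syntactic check, so that for a concrete program and a concrete variable the frame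
-- condition is proved by `refl`.
mutatesVar : Program → Var → Bool
mutatesVar skip          x = false
mutatesVar (set y e)     x = x ≡ᵇ y
mutatesVar (write a e f) x = false
mutatesVar (c ⨾ d)       x = mutatesVar c x ∨ mutatesVar d x
mutatesVar (cond e c d)  x = mutatesVar c x ∨ mutatesVar d x
mutatesVar (while e c)   x = mutatesVar c x

mutatesArr : Program → Arr → Bool
mutatesArr skip          a = false
mutatesArr (set y e)     a = false
mutatesArr (write b e f) a = a ≡ᵇ b
mutatesArr (c ⨾ d)       a = mutatesArr c a ∨ mutatesArr d a
mutatesArr (cond e c d)  a = mutatesArr c a ∨ mutatesArr d a
mutatesArr (while e c)   a = mutatesArr c a

record Frame (c : Program) (s s′ : Memory) : Set where
  constructor frame
  field
    same-var : ∀ x → mutatesVar c x ≡ false → vars s′ x ≡ vars s x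
    same-arr : ∀ a → mutatesArr c a ≡ false → arrs s′ a ≡ arrs s a

open Frame

∨-false : ∀ {a b} → a ∨ b ≡ false → a ≡ false × b ≡ false
∨-false {false} {false} _ = refl , refl

run-frame : ∀ {c s t s′} → ⟨ c , s ⟩⇓[ t ] s′ → Frame c s s′
run-frame run-skip = frame (λ _ _ → refl) (λ _ _ → refl)
run-frame (run-set {s} {x} {e}) =
  -- The update branches on `does (y ≟ x)`, which computes to `y ≡ᵇ x`, the Boolean that the
  -- hypothesis says is `false`.
  frame (λ y y≢x → cong (if_then ⟦ e ⟧ s else vars s y) y≢x) (λ _ _ → refl)
run-frame (run-write {s} {a} {e} {f}) =
  frame (λ _ _ → refl)
        (λ b b≢a → cong (if_then arrs s a [ ⟦ e ⟧ s ≔ ⟦ f ⟧ s ] else arrs s b) b≢a)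
run-frame (run-seq p q) with run-frame p | run-frame q
... | frame v a | frame v′ a′ = frame
  (λ x eq → let l , r = ∨-false eq in trans (v′ x r) (v x l))
  (λ x eq → let l , r = ∨-false eq in trans (a′ x r) (a x l))
run-frame (run-then _ p) with run-frame p
... | frame v a = frame (λ x eq → v x (proj₁ (∨-false eq))) (λ x eq → a x (proj₁ (∨-false eq)))
run-frame (run-else _ p) with run-frame p
... | frame v a = frame
  (λ x eq → v x (proj₂ (∨-false eq))) (λ x eq → a x (proj₂ (∨-false eq)))
run-frame (run-stop _) = frame (λ _ _ → refl) (λ _ _ → refl)
run-frame (run-loop _ p q) with run-frame p | run-frame q
... | frame v a | frame v′ a′ = frame
  (λ x eq → trans (v′ x eq) (v x eq)) (λ x eq → trans (a′ x eq) (a x eq))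

-- A total-correctness triple for a fixed start state. The time is only bounded, so branches of
-- different cost can be joined.
record Runs (c : Program) (s : Memory) (t : ℕ) (Q : Memory → Set) : Set where
  constructor runs
  field
    {final} : Memory
    {time}  : ℕ
    run     : ⟨ c , s ⟩⇓[ time ] final
    within  : time ≤ t
    post    : Q final

module _ {c : Program} {s : Memory} {Q : Memory → Set} where

  weaken : ∀ {t u} {R : Memory → Set} → t ≤ u → (∀ {s′} → Q s′ → R s′) →
           Runs c s t Q → Runs c s u R
  weaken t≤u Q⇒R (runs p le q) = runs p (≤-trans le t≤u) (Q⇒R q)

  framed : ∀ {t} → Runs c s t Q → Runs c s t (λ s′ → Frame c s s′ × Q s′)
  framed (runs p le q) = runs p le (run-frame p , q)

  seq-rule : ∀ {d t u} {R : Memory → Set} → Runs c s t Q →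
             (∀ {s′} → Frame c s s′ → Q s′ → Runs d s′ u R) → Runs (c ⨾ d) s (t + u) R
  seq-rule (runs p le q) k with k (run-frame p) q
  ... | runs p′ le′ r = runs (run-seq p p′) (+-mono-≤ le le′) r

module _ {s : Memory} {Q : Memory → Set} where

  skip-rule : Q s → Runs skip s 1 Q
  skip-rule = runs run-skip ≤-refl

  set-rule : ∀ {x e} → Q (setVar x (⟦ e ⟧ s) s) → Runs (set x e) s 1 Q
  set-rule = runs run-set ≤-refl

  write-rule : ∀ {a e f} → Q (writeArr a (⟦ e ⟧ s) (⟦ f ⟧ s) s) → Runs (write a e f) s 1 Q
  write-rule = runs run-write ≤-refl

  set-then : ∀ {x e d t} → Runs d (setVar x (⟦ e ⟧ s) s) t Q → Runs (set x e ⨾ d) s (suc t) Q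
  set-then (runs p le q) = runs (run-seq run-set p) (s≤s le) q

  write-then : ∀ {a e f d t} → Runs d (writeArr a (⟦ e ⟧ s) (⟦ f ⟧ s) s) t Q →
               Runs (write a e f ⨾ d) s (suc t) Q
  write-then (runs p le q) = runs (run-seq run-write p) (s≤s le) q

  cond-rule : ∀ {e c d t} → (⟦ e ⟧ s ≢ 0 → Runs c s t Q) → (⟦ e ⟧ s ≡ 0 → Runs d s t Q) →
              Runs (cond e c d) s (suc t) Q
  cond-rule {e} f g with ⟦ e ⟧ s ℕ.≟ 0
  ... | yes eq with runs p le q ← g eq = runs (run-else eq p) (s≤s le) q
  ... | no  ne with runs p le q ← f ne = runs (run-then ne p) (s≤s le) q

-- Amortised analysis: the potential carried by the invariant pays for each iteration and its test,
-- and the failing test at the end adds 1. As every iteration costs at least 1, the potential also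
-- proves termination.
while-rule : ∀ {e c} (I : ℕ → Memory → Set) →
  (∀ {φ s} → I φ s → ⟦ e ⟧ s ≢ 0 →
    ∃ λ t → Runs c s t (λ s′ → ∃ λ φ′ → suc t + φ′ ≤ φ × I φ′ s′)) →
  ∀ {φ s} → I φ s → Runs (while e c) s (suc φ) (λ s′ → ∃ (λ φ′ → I φ′ s′) × ⟦ e ⟧ s′ ≡ 0)
while-rule {e} {c} I step {φ} = go φ ≤-refl
  where
  -- The potential may drop by any positive amount, so the recursion runs on an upper bound `N` that
  -- decreases by exactly 1.
  go : ∀ N {φ s} → φ ≤ N → I φ s →
       Runs (while e c) s (suc φ) (λ s′ → ∃ (λ φ′ → I φ′ s′) × ⟦ e ⟧ s′ ≡ 0)
  go N {φ} {s} φ≤N i with ⟦ e ⟧ s ℕ.≟ 0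
  ... | yes eq = runs (run-stop eq) (s≤s z≤n) ((φ , i) , eq)
  ... | no  ne with step i ne
  go zero    z≤n   i | no ne | t , runs p le (φ′ , () , i′)
  go (suc N) {φ} φ≤N i | no ne | t , runs {time = t₁} p le (φ′ , dec , i′)
    with go N (s≤s⁻¹ (≤-trans (s≤s (m≤n+m φ′ t)) (≤-trans dec φ≤N))) i′
  ... | runs {time = t₂} p′ le′ q = runs (run-loop ne p p′) (s≤s (begin
      t₁ + t₂      ≤⟨ +-mono-≤ le le′ ⟩
      t + suc φ′   ≡⟨ +-suc t φ′ ⟩
      suc t + φ′   ≤⟨ dec ⟩
      φ            ∎)) q
    where open ≤-Reasoning

forLoop : Var → Expr → Expr → Program → Program
forLoop x lo hi c = set x lo ⨾ while (sub hi (var x)) (c ⨾ set x (inc (var x)))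

≡ᵇ-refl : ∀ n → (n ≡ᵇ n) ≡ true
≡ᵇ-refl zero    = refl
≡ᵇ-refl (suc n) = ≡ᵇ-refl n

update-at : ∀ {A : Set} (f : ℕ → A) i {x} → (f [ i ≔ x ]) i ≡ x
update-at f i {x} = cong (if_then x else f i) (≡ᵇ-refl i)

update-off : ∀ {A : Set} (f : ℕ → A) {i x j} → j ≢ i → (f [ i ≔ x ]) j ≡ f j
update-off f {i} {x} {j} j≢i with j ≡ᵇ i | ≡ᵇ⇒≡ j i
... | true  | j≡i = contradiction (j≡i _) j≢i
... | false | _   = refl

-- The upper limit is evaluated anew in every round, so it must keep its value in all states that
-- agree with `s₀` off the cells the loop mutates. Each round adds a test and an increment to `k`;
-- the leading 2 is the initial assignment and the last test.
for-rule : ∀ {x lo hi c s₀} a b k (I : ℕ → Memory → Set) →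
  mutatesVar c x ≡ false → a ≤ b →
  ⟦ lo ⟧ s₀ ≡ a →
  (∀ {s} → Frame (forLoop x lo hi c) s₀ s → ⟦ hi ⟧ s ≡ b) →
  I a (setVar x a s₀) →
  (∀ {i s} → Frame (forLoop x lo hi c) s₀ s → a ≤ i → i < b → vars s x ≡ i → I i s →
    Runs c s k (λ s′ → I (suc i) (setVar x (suc i) s′))) →
  Runs (forLoop x lo hi c) s₀ (2 + (b ∸ a) * (2 + k)) (I b)
for-rule {x} {lo} {hi} {c} {s₀} _ b k I x∉c a≤b refl hi≡ init step =
  set-then (weaken ≤-refl finish (while-rule Inv body
    (a , refl , ≤-refl , a≤b , at , frame (λ _ _ → refl) (λ _ _ → refl) , init)))
  where
  a = ⟦ lo ⟧ s₀
  s₁ = setVar x a s₀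
  step′ = c ⨾ set x (inc (var x))
  loop = forLoop x lo hi c
  at : vars s₁ x ≡ a
  at = update-at (vars s₀) x

  Inv : ℕ → Memory → Set
  Inv φ s = ∃ λ i → φ ≡ (b ∸ i) * (2 + k) × a ≤ i × i ≤ b × vars s x ≡ i × Frame step′ s₁ s × I i s

  whole : ∀ {s} → Frame step′ s₁ s → Frame loop s₀ s
  whole (frame v a) = frame
    (λ y eq → let y≢x , rest = ∨-false eq in
      trans (v y rest) (cong (if_then ⟦ lo ⟧ s₀ else vars s₀ y) y≢x))
    a

  finish : ∀ {s} → ∃ (λ φ → Inv φ s) × ⟦ hi ⟧ s ∸ vars s x ≡ 0 → I b s
  finish {s} ((φ , i , _ , _ , i≤b , x≡i , fr , inv) , eq) =
    subst (λ j → I j s) (≤-antisym i≤b (m∸n≡0⇒m≤n (trans (sym (cong₂ _∸_ (hi≡ (whole fr)) x≡i)) eq))) inv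

  body : ∀ {φ s} → Inv φ s → ⟦ hi ⟧ s ∸ vars s x ≢ 0 →
         ∃ λ t → Runs step′ s t (λ s′ → ∃ λ φ′ → suc t + φ′ ≤ φ × Inv φ′ s′)
  body {s = s} (i , refl , a≤i , i≤b , x≡i , fr , inv) ne =
    k + 1 , seq-rule (step (whole fr) a≤i i<b x≡i inv) λ {s′} fr′ inv′ →
      let x′≡i = trans (same-var fr′ x x∉c) x≡i in
      set-rule ((b ∸ suc i) * (2 + k) ,
        ≤-reflexive (trans (cong (λ z → suc z + (b ∸ suc i) * (2 + k)) (+-comm k 1))
                           (cong (_* (2 + k)) (sym (+-∸-assoc 1 i<b)))) ,
        suc i , refl , m≤n⇒m≤1+n a≤i , i<b ,
        trans (update-at (vars s′) x) (cong suc x′≡i) ,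
        frame (λ y eq → let l , y≢x = ∨-false eq in
                 trans (cong (if_then suc (vars s′ x) else vars s′ y) y≢x)
                       (trans (same-var fr′ y l) (same-var fr y eq)))
              (λ a eq → trans (same-arr fr′ a (proj₁ (∨-false eq))) (same-arr fr a eq)) ,
        subst (λ v → I (suc i) (setVar x v s′)) (cong suc (sym x′≡i)) inv′)
    where
    i<b : i < b
    i<b = ≰⇒> λ b≤i → ne (m≤n⇒m∸n≡0 (≤-trans (≤-reflexive (hi≡ (whole fr)))
      (≤-trans b≤i (≤-reflexive (sym x≡i)))))

-- Breadth-first search

-- For g ∈ {1, 2} and m ∈ {0, 1} this is 2 if m = 1 and g otherwise.
stageAfter : ℕ → ℕ → ℕ
stageAfter g m = 2 ∸ ((2 ∸ g) ∸ m)

stageAfter-mono : ∀ {g h} m → g ≤ h → stageAfter g m ≤ stageAfter h m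
stageAfter-mono m g≤h = ∸-monoʳ-≤ 2 (∸-monoˡ-≤ m (∸-monoʳ-≤ 2 g≤h))

stageAfter-≥ : ∀ {g} m → g ≤ 2 → g ≤ stageAfter g m
stageAfter-≥ {g} m g≤2 = begin
  g                  ≡⟨ m∸[m∸n]≡n g≤2 ⟨
  2 ∸ (2 ∸ g)        ≤⟨ ∸-monoʳ-≤ 2 (m∸n≤m (2 ∸ g) m) ⟩
  stageAfter g m     ∎
  where open ≤-Reasoning

partialSum : (ℕ → ℕ) → ℕ → ℕ
partialSum f zero    = 0
partialSum f (suc k) = partialSum f k + f k

partialSum-cong : ∀ {f g} k → (∀ i → i < k → f i ≡ g i) → partialSum f k ≡ partialSum g k
partialSum-cong zero    eq = refl
partialSum-cong (suc k) eq =
  cong₂ _+_ (partialSum-cong k (λ i i<k → eq i (m<n⇒m<1+n i<k))) (eq k ≤-refl)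

partialSum-mono : ∀ f {j k} → j ≤ k → partialSum f j ≤ partialSum f k
partialSum-mono f {j} {k} j≤k with ≤⇒≤′ j≤k
... | ≤′-reflexive refl = ≤-refl
... | ≤′-step j≤′k = ≤-trans (partialSum-mono f (≤′⇒≤ j≤′k)) (m≤m+n _ _)

sum-decrease : ∀ {n} {f g : Fin n → ℕ} {c} (w : Fin n) → f w + c ≤ g w →
               (∀ v → v ≢ w → f v ≤ g v) → sum f + c ≤ sum g
sum-decrease {f = f} {g} {c} zero dec le = begin
  f zero + sum (f ∘ suc) + c      ≡⟨ swap (f zero) _ c ⟩
  f zero + c + sum (f ∘ suc)      ≤⟨ +-mono-≤ dec (sum-mono-≤ (λ v → le (suc v) λ ())) ⟩
  sum g                           ∎
  where
  open ≤-Reasoning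
  swap : ∀ a b c → a + b + c ≡ a + c + b
  swap = solve-∀
sum-decrease {f = f} {c = c} (suc w) dec le = ≤-trans (≤-reflexive (+-assoc (f zero) _ c))
  (+-mono-≤ (le zero λ ()) (sum-decrease w dec (λ v v≢w → le (suc v) (v≢w ∘ Fin.suc-injective))))

-- The state of a breadth-first search from P.  A vertex is at stage 1 once it
-- has been reached by a walk, at stage 2 once it has been reached by a walk
-- that meets X, and is queued whenever its stage increases.
record Queue : Set where
  constructor queue
  field
    stage vertex level depth : ℕ → ℕ
    size : ℕ

open Queue

push : ℕ → ℕ → ℕ → Queue → Queue
push w h e (queue st vs ls ds T) =
  queue (st [ w ≔ h ]) (vs [ T ≔ w ]) (ls [ T ≔ h ]) (ds [ T ≔ e ]) (suc T)

module Search {n} (G : Graph n) (P X : Subset n) (r : ℕ) (weight : ℕ → ℕ) where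

  mark : Fin n → ℕ
  mark v = indicator (v ∈? X)

  -- Walks in the product of `G` with the two-state automaton that remembers whether `X` has been
  -- met.
  data Trail : ℕ → Fin n → ℕ → Set where
    source : ∀ {p} → p ∈ P → Trail 0 p (stageAfter 1 (mark p))
    step   : ∀ {d u g w} → Trail d u g → Adj G u w → Trail (suc d) w (stageAfter g (mark w))

  trail-≤2 : ∀ {d v g} → Trail d v g → g ≤ 2
  trail-≤2 (source {p} _)    = m∸n≤m 2 (1 ∸ mark p)
  trail-≤2 (step {g = g} {w} _ _) = m∸n≤m 2 ((2 ∸ g) ∸ mark w)

  trail-≥1 : ∀ {d v g} → Trail d v g → 1 ≤ g
  trail-≥1 (source {p} _)    = stageAfter-≥ {1} (mark p) (s≤s z≤n)
  trail-≥1 (step {w = w} t _) = ≤-trans (trail-≥1 t) (stageAfter-≥ (mark w) (trail-≤2 t))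

  trail-walk : ∀ {d v g} → Trail d v g → ∃ λ p → p ∈ P × Walk G d p v
  trail-walk (source p∈) = _ , p∈ , refl
  trail-walk (step t uw) = let p , p∈ , pu = trail-walk t in p , p∈ , walk-snoc G _ pu uw

  Meets : ℕ → Fin n → Set
  Meets d v = ∃ λ p → ∃ λ u → ∃ λ a → ∃ λ b →
    p ∈ P × u ∈ X × Walk G a p u × Walk G b u v × a + b ≡ d

  -- Traced back from the end, the first vertex found in `X` is the meeting point. A step to a
  -- vertex outside `X` does not raise the stage, so stage 2 was already reached before it.
  trail-meets : ∀ {d v g} → Trail d v g → 2 ≤ g → Meets d v
  trail-meets (source {p} p∈) 2≤g with p ∈? X
  ... | yes p∈X = p , p , 0 , 0 , p∈ , p∈X , refl , refl , refl
  trail-meets (source p∈) (s≤s ()) | no _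
  trail-meets {suc d} (step {g = g} {w} t uw) 2≤g with w ∈? X
  ... | yes w∈X = let p , p∈ , pw = trail-walk (step t uw) in
    p , w , suc d , 0 , p∈ , w∈X , pw , refl , +-identityʳ (suc d)
  ... | no _ =
    let p , x , a , b , p∈ , x∈ , px , xu , eq = trail-meets t (old g 2≤g) in
    p , x , a , suc b , p∈ , x∈ , px , walk-snoc G b xu uw , trans (+-suc a b) (cong suc eq)
    where
    old : ∀ g → 2 ≤ stageAfter g 0 → 2 ≤ g
    old (suc zero)    (s≤s ())
    old (suc (suc g)) _ = s≤s (s≤s z≤n)

  extend : ∀ {d u g} b {v} → Trail d u g → Walk G b u v → ∃ λ h → Trail (d + b) v h × g ≤ h
  extend {d} zero t refl = _ , subst (λ d → Trail d _ _) (sym (+-identityʳ d)) t , ≤-refl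
  extend {d} (suc b) {v} t (x , ux , xv) =
    let h , t′ , le = extend b (step t ux) xv in
    h , subst (λ d → Trail d v h) (sym (+-suc d b)) t′ , ≤-trans (stageAfter-≥ (mark x) (trail-≤2 t)) le

  mark-∈ : ∀ {v} → v ∈ X → mark v ≡ 1
  mark-∈ {v} v∈ with v ∈? X
  ... | yes _  = refl
  ... | no v∉ = contradiction v∈ v∉

  trail-∈ : ∀ {d v g} → Trail d v g → v ∈ X → 2 ≤ g
  trail-∈ (source p∈)            v∈ rewrite mark-∈ v∈ = ≤-refl
  trail-∈ (step {g = suc g} t _) v∈ rewrite mark-∈ v∈ | m≤n⇒m∸n≡0 (m∸n≤m 1 g) = ≤-refl
  trail-∈ (step {g = zero} t _)  v∈ = contradiction (trail-≥1 t) λ ()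

  meets-trail : ∀ {d v} → Meets d v → ∃ λ g → Trail d v g × 2 ≤ g
  meets-trail (p , u , a , b , p∈ , u∈ , pu , uv , refl) =
    let _ , t , _ = extend a (source p∈) pu
        g , t′ , le = extend b t uv
    in g , t′ , ≤-trans (trail-∈ t u∈) le

  -- Dominance: some entry for `v` is at least as good in both stage and depth. Any continuation of
  -- a trail is matched from a dominating entry, so dominated trails may be dropped.
  Covered : Queue → Fin n → ℕ → ℕ → Set
  Covered q v g d = ∃ λ i → i < size q × vertex q i ≡ toℕ v × g ≤ level q i × depth q i ≤ d

  covered-weaken : ∀ {q v g g′ d d′} → g′ ≤ g → d ≤ d′ → Covered q v g d → Covered q v g′ d′
  covered-weaken g′≤g d≤d′ (i , i< , v≡ , g≤ , ≤d) = i , i< , v≡ , ≤-trans g′≤g g≤ , ≤-trans ≤d d≤d′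

  total : ℕ
  total = sum {n} (λ v → weight (toℕ v))

  -- `e` is the depth given to entries that are being appended. Since it bounds all depths so far,
  -- appending keeps the queue sorted.
  record Valid (e : ℕ) (q : Queue) : Set where
    field
      entry    : ∀ i → i < size q → ∃ λ v → vertex q i ≡ toℕ v × Trail (depth q i) v (level q i) ×
                   level q i ≤ stage q (toℕ v)
      depth≤e  : ∀ i → i < size q → depth q i ≤ e
      depth≤r  : ∀ i → i < size q → depth q i ≤ r
      sorted   : ∀ i j → i ≤ j → j < size q → depth q i ≤ depth q j
      recorded : ∀ (v : Fin n) → stage q (toℕ v) ≡ 0 ⊎
                   ∃ λ i → i < size q × vertex q i ≡ toℕ v × level q i ≡ stage q (toℕ v)
      -- The increase of a stage pays for popping the entry that is queued with it.
      budget   : partialSum (weight ∘ vertex q) (size q) +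
                   sum {n} (λ v → (2 ∸ stage q (toℕ v)) * weight (toℕ v)) ≤ 2 * total

  open Valid

  valid-weaken : ∀ {e e′ q} → (∀ i → i < size q → depth q i ≤ e′) → Valid e q → Valid e′ q
  valid-weaken le v = record
    { entry = entry v ; depth≤e = le ; depth≤r = depth≤r v ; sorted = sorted v
    ; recorded = recorded v ; budget = budget v }

  valid-empty : ∀ {q} → size q ≡ 0 → (∀ (v : Fin n) → stage q (toℕ v) ≡ 0) → Valid 0 q
  valid-empty {q} refl st0 = record
    { entry = λ _ () ; depth≤e = λ _ () ; depth≤r = λ _ () ; sorted = λ _ _ _ ()
    ; recorded = λ v → inj₁ (st0 v)
    ; budget = ≤-reflexive (trans
        (sum-cong-≗ unspent)
        (double n (λ v → weight (toℕ v)))) }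
    where
    unspent : ∀ (v : Fin n) → (2 ∸ stage q (toℕ v)) * weight (toℕ v) ≡ 2 * weight (toℕ v)
    unspent v rewrite st0 v = refl
    double : ∀ n (f : Fin n → ℕ) → sum (λ v → 2 * f v) ≡ 2 * sum f
    double n f = trans (∑-distrib-+ f (λ v → f v + 0))
      (cong (sum f +_) (trans (∑-distrib-+ f (λ _ → 0)) (cong (sum f +_) (zeros n))))
      where
      zeros : ∀ n → sum {n} (λ _ → 0) ≡ 0
      zeros zero    = refl
      zeros (suc n) = zeros n

  record Extends (e : ℕ) (q q′ : Queue) : Set where
    field
      grows   : size q ≤ size q′
      vertex≡ : ∀ i → i < size q → vertex q′ i ≡ vertex q i
      level≡  : ∀ i → i < size q → level q′ i ≡ level q i
      depth≡  : ∀ i → i < size q → depth q′ i ≡ depth q i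
      fresh   : ∀ i → size q ≤ i → i < size q′ → depth q′ i ≡ e

  open Extends

  extends-refl : ∀ {e q} → Extends e q q
  extends-refl = record
    { grows = ≤-refl ; vertex≡ = λ _ _ → refl ; level≡ = λ _ _ → refl ; depth≡ = λ _ _ → refl
    ; fresh = λ _ ≤i i< → contradiction i< (≤⇒≯ ≤i) }

  extends-trans : ∀ {e q q′ q″} → Extends e q q′ → Extends e q′ q″ → Extends e q q″
  extends-trans {e} {q} {q′} {q″} x y = record
    { grows   = ≤-trans (grows x) (grows y)
    ; vertex≡ = λ i i< → trans (vertex≡ y i (≤-trans i< (grows x))) (vertex≡ x i i<)
    ; level≡  = λ i i< → trans (level≡ y i (≤-trans i< (grows x))) (level≡ x i i<)
    ; depth≡  = λ i i< → trans (depth≡ y i (≤-trans i< (grows x))) (depth≡ x i i<)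
    ; fresh   = new }
    where
    new : ∀ i → size q ≤ i → i < size q″ → depth q″ i ≡ e
    new i ≤i i< with i <? size q′
    ... | yes i<′ = trans (depth≡ y i i<′) (fresh x i ≤i i<′)
    ... | no  i≮  = fresh y i (≮⇒≥ i≮) i<

  covered-extends : ∀ {e q q′ v g d} → Extends e q q′ → Covered q v g d → Covered q′ v g d
  covered-extends x (i , i< , v≡ , g≤ , ≤d) =
    i , ≤-trans i< (grows x) , trans (vertex≡ x i i<) v≡ ,
    ≤-trans g≤ (≤-reflexive (sym (level≡ x i i<))) , ≤-trans (≤-reflexive (depth≡ x i i<)) ≤d

  module _ {e : ℕ} {q : Queue} (valid : Valid e q) (e≤r : e ≤ r)
           {w : Fin n} {h : ℕ} (trail : Trail e w h) where

    -- The entry that recorded the present stage came earlier, so it is no deeper than `e`. There is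
    -- such an entry because trails have stage at least 1.
    covered-already : h ≤ stage q (toℕ w) → Covered q w h e
    covered-already h≤ with recorded valid w
    ... | inj₁ eq = contradiction (≤-trans (trail-≥1 trail) (≤-trans h≤ (≤-reflexive eq))) λ ()
    ... | inj₂ (i , i< , v≡ , l≡) =
      i , i< , v≡ , ≤-trans h≤ (≤-reflexive (sym l≡)) , depth≤e valid i i<

    private
      T = size q
      q⁺ = push (toℕ w) h e q

      old : ∀ (f : ℕ → ℕ) {x i} → i < T → (f [ T ≔ x ]) i ≡ f i
      old f i<T = update-off f (<⇒≢ i<T)

    extends-push : Extends e q q⁺
    extends-push = record
      { grows   = n≤1+n T
      ; vertex≡ = λ _ → old (vertex q)
      ; level≡  = λ _ → old (level q)
      ; depth≡  = λ _ → old (depth q)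
      ; fresh   = λ i ≤i i< → subst (λ j → (depth q [ T ≔ e ]) j ≡ e)
                    (≤-antisym ≤i (s≤s⁻¹ i<)) (update-at (depth q) T) }

    covered-push : Covered q⁺ w h e
    covered-push = T , ≤-refl , update-at (vertex q) T ,
      ≤-reflexive (sym (update-at (level q) T)) , ≤-reflexive (update-at (depth q) T)

    module _ (grow : stage q (toℕ w) < h) where

      private
        cases : ∀ {i} → i < suc T → i < T ⊎ i ≡ T
        cases i< = m≤n⇒m<n∨m≡n (s≤s⁻¹ i<)

        st = stage q
        st⁺ = stage q⁺

        st-at : st⁺ (toℕ w) ≡ h
        st-at = update-at st (toℕ w)

        st-off : ∀ {v} → v ≢ w → st⁺ (toℕ v) ≡ st (toℕ v)
        st-off v≢w = update-off st (v≢w ∘ Fin.toℕ-injective)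

        st-mono : ∀ v → st (toℕ v) ≤ st⁺ (toℕ v)
        st-mono v with v Fin.≟ w
        ... | yes refl = ≤-trans (<⇒≤ grow) (≤-reflexive (sym st-at))
        ... | no  v≢w  = ≤-reflexive (sym (st-off v≢w))

        depth⁺≤ : ∀ {b} → (∀ i → i < T → depth q i ≤ b) → e ≤ b → ∀ i → i < suc T → depth q⁺ i ≤ b
        depth⁺≤ le e≤b i i< with cases i<
        ... | inj₁ i<T  = ≤-trans (≤-reflexive (old (depth q) i<T)) (le i i<T)
        ... | inj₂ refl = ≤-trans (≤-reflexive (update-at (depth q) T)) e≤b

        entry⁺ : ∀ i → i < suc T → ∃ λ v → vertex q⁺ i ≡ toℕ v ×
                 Trail (depth q⁺ i) v (level q⁺ i) × level q⁺ i ≤ st⁺ (toℕ v)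
        entry⁺ i i< with cases i<
        ... | inj₁ i<T rewrite old (vertex q) {toℕ w} i<T | old (level q) {h} i<T | old (depth q) {e} i<T =
          let v , v≡ , t , l≤ = entry valid i i<T in v , v≡ , t , ≤-trans l≤ (st-mono v)
        ... | inj₂ refl rewrite update-at (vertex q) T {toℕ w} | update-at (level q) T {h}
                              | update-at (depth q) T {e} =
          w , refl , trail , ≤-reflexive (sym st-at)

        sorted⁺ : ∀ i j → i ≤ j → j < suc T → depth q⁺ i ≤ depth q⁺ j
        sorted⁺ i j i≤j j< with cases j<
        ... | inj₁ j<T rewrite old (depth q) {e} j<T | old (depth q) {e} (≤-trans (s≤s i≤j) j<T) =
          sorted valid i j i≤j j<T
        ... | inj₂ refl rewrite update-at (depth q) T {e} =
          depth⁺≤ (depth≤e valid) ≤-refl i (s≤s i≤j)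

        recorded⁺ : ∀ v → st⁺ (toℕ v) ≡ 0 ⊎
          ∃ λ i → i < suc T × vertex q⁺ i ≡ toℕ v × level q⁺ i ≡ st⁺ (toℕ v)
        recorded⁺ v with v Fin.≟ w
        ... | yes refl = inj₂ (T , ≤-refl , update-at (vertex q) T ,
                               trans (update-at (level q) T) (sym st-at))
        ... | no v≢w with recorded valid v
        ...   | inj₁ eq = inj₁ (trans (st-off v≢w) eq)
        ...   | inj₂ (i , i< , v≡ , l≡) =
          inj₂ (i , m<n⇒m<1+n i< , trans (old (vertex q) i<) v≡ ,
                trans (old (level q) i<) (trans l≡ (sym (st-off v≢w))))

        wt : Fin n → ℕ
        wt v = weight (toℕ v)

        -- Stages never exceed 2, so a strict increase at `w` releases at least one full `wt w`, the
        -- price of the new entry.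
        paid : sum (λ v → (2 ∸ st⁺ (toℕ v)) * wt v) + wt w ≤ sum (λ v → (2 ∸ st (toℕ v)) * wt v)
        paid = sum-decrease w
          (begin
            (2 ∸ st⁺ (toℕ w)) * wt w + wt w ≡⟨ cong (λ z → (2 ∸ z) * wt w + wt w) st-at ⟩
            (2 ∸ h) * wt w + wt w           ≡⟨ +-comm _ (wt w) ⟩
            suc (2 ∸ h) * wt w              ≡⟨ cong (_* wt w) (+-∸-assoc 1 (trail-≤2 trail)) ⟨
            (3 ∸ h) * wt w                  ≤⟨ *-monoˡ-≤ (wt w) (∸-monoʳ-≤ 3 grow) ⟩
            (2 ∸ st (toℕ w)) * wt w         ∎)
          (λ v v≢w → ≤-reflexive (cong (λ z → (2 ∸ z) * wt v) (st-off v≢w)))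
          where open ≤-Reasoning

        budget⁺ : partialSum (weight ∘ vertex q⁺) (suc T) + sum (λ v → (2 ∸ st⁺ (toℕ v)) * wt v) ≤ 2 * total
        budget⁺ = begin
          partialSum (weight ∘ vertex q⁺) T + weight (vertex q⁺ T) + rest⁺
            ≡⟨ cong₂ (λ x y → x + y + rest⁺)
                 (partialSum-cong T (λ i i<T → cong weight (old (vertex q) i<T)))
                 (cong weight (update-at (vertex q) T)) ⟩
          spent + wt w + rest⁺    ≡⟨ swap spent (wt w) rest⁺ ⟩
          spent + (rest⁺ + wt w)  ≤⟨ +-monoʳ-≤ spent paid ⟩
          spent + sum (λ v → (2 ∸ st (toℕ v)) * wt v) ≤⟨ budget valid ⟩
          2 * total               ∎
          where
          open ≤-Reasoning
          spent = partialSum (weight ∘ vertex q) T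
          rest⁺ = sum (λ v → (2 ∸ st⁺ (toℕ v)) * wt v)
          swap : ∀ a b c → a + b + c ≡ a + (c + b)
          swap = solve-∀

      valid-push : Valid e q⁺
      valid-push = record
        { entry    = entry⁺
        ; depth≤e  = depth⁺≤ (depth≤e valid) ≤-refl
        ; depth≤r  = depth⁺≤ (depth≤r valid) e≤r
        ; sorted   = sorted⁺
        ; recorded = recorded⁺
        ; budget   = budget⁺ }

  Processed : Queue → ℕ → Set
  Processed q H = ∀ i → i < H → suc (depth q i) ≤ r → ∀ v → vertex q i ≡ toℕ v →
    ∀ w → Adj G v w → Covered q w (stageAfter (level q i) (mark w)) (suc (depth q i))

  Sources : Queue → Set
  Sources q = ∀ p → p ∈ P → Covered q p (stageAfter 1 (mark p)) 0

  -- `lag` is the classical two-level property of a breadth-first queue. It makes `suc (depth q H)`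
  -- an admissible `e` for `Valid` when the entry `H` is popped.
  record Progress (H : ℕ) (q : Queue) : Set where
    field
      {front}   : ℕ
      valid     : Valid front q
      head≤     : H ≤ size q
      lag       : ∀ i → H ≤ i → i < size q → ∀ j → j < size q → depth q j ≤ suc (depth q i)
      processed : Processed q H
      sources   : Sources q

  open Progress

  progress-start : ∀ {q} → Valid 0 q → Sources q → Progress 0 q
  progress-start v src = record
    { valid = v ; head≤ = z≤n ; processed = λ _ () ; sources = src
    ; lag = λ _ _ _ j j< → ≤-trans (depth≤e v j j<) z≤n }

  progress-step : ∀ {H q q′} → Progress H q → H < size q →
    Valid (suc (depth q H)) q′ → Extends (suc (depth q H)) q q′ →
    (suc (depth q H) ≤ r → ∀ v → vertex q H ≡ toℕ v →
      ∀ w → Adj G v w → Covered q′ w (stageAfter (level q H) (mark w)) (suc (depth q H))) →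
    Progress (suc H) q′
  progress-step {H} {q} {q′} pr H< v′ x new = record
    { valid     = v′
    ; head≤     = ≤-trans H< (grows x)
    -- All depths are at most one more than that of the popped entry, and by sortedness no waiting
    -- entry is shallower than it.
    ; lag       = λ i H<i i< j j< → ≤-trans (depth≤e v′ j j<) (s≤s (later i (<⇒≤ H<i) i<))
    ; processed = done
    ; sources   = λ p p∈ → covered-extends x (sources pr p p∈) }
    where
    later : ∀ i → H ≤ i → i < size q′ → depth q H ≤ depth q′ i
    later i H≤i i< = ≤-trans (≤-reflexive (sym (depth≡ x H H<))) (sorted v′ H i H≤i i<)

    done : Processed q′ (suc H)
    done i i< with m≤n⇒m<n∨m≡n (s≤s⁻¹ i<)
    ... | inj₁ i<H rewrite depth≡ x i (<-trans i<H H<) | level≡ x i (<-trans i<H H<)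
                         | vertex≡ x i (<-trans i<H H<) =
      λ le v v≡ w vw → covered-extends x (processed pr i i<H le v v≡ w vw)
    ... | inj₂ refl rewrite depth≡ x i H< | level≡ x i H< | vertex≡ x i H< = new

  module _ {H q} (pr : Progress H q) (finished : size q ≤ H) where

    -- Induction on the trail. The entry dominating its penultimate vertex has been popped at depth
    -- less than `r`, hence expanded, and monotonicity of `stageAfter` carries dominance across the
    -- last edge.
    covers : ∀ {d v g} → Trail d v g → d ≤ r → Covered q v g d
    covers (source p∈) _ = sources pr _ p∈
    covers (step {d} {w = w} t uw) d<r =
      let i , i< , u≡ , g≤ , ≤d = covers t (<⇒≤ d<r) in
      covered-weaken {q} {w} (stageAfter-mono (mark w) g≤) (s≤s ≤d)
        (processed pr i (≤-trans i< finished) (≤-trans (s≤s ≤d) d<r) _ u≡ w uw)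

    stage-complete : ∀ {d v} → Meets d v → d ≤ r → 2 ≤ stage q (toℕ v)
    stage-complete {v = v} m d≤r =
      let g , t , 2≤g = meets-trail m
          i , i< , v≡ , g≤ , _ = covers t d≤r
          v′ , v′≡ , _ , l≤ = entry (valid pr) i i<
      in ≤-trans 2≤g (≤-trans g≤ (≤-trans l≤ (≤-reflexive (cong (stage q) (trans (sym v′≡) v≡)))))

    stage-sound : ∀ {v} → 2 ≤ stage q (toℕ v) → ∃ λ d → d ≤ r × Meets d v
    stage-sound {v} 2≤ with recorded (valid pr) v
    ... | inj₁ eq = contradiction (≤-trans 2≤ (≤-reflexive eq)) λ ()
    ... | inj₂ (i , i< , v≡ , l≡) =
      let v′ , v′≡ , t , _ = entry (valid pr) i i<
      in depth q i , depth≤r (valid pr) i i< ,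
         trail-meets (subst (λ v → Trail _ v _) (Fin.toℕ-injective (trans (sym v′≡) v≡)) t)
           (≤-trans 2≤ (≤-reflexive (sym l≡)))

    open Construction G P r using (NewBag; through; through⁻)

    newBag⇒ : ∀ {v} → NewBag X v → v ∈ X ⊎ 2 ≤ stage q (toℕ v)
    newBag⇒ (inj₁ v∈) = inj₁ v∈
    newBag⇒ {v} (inj₂ th) = let p , u , a , b , p∈ , u∈ , pu , uv , le = through⁻ th in
      inj₂ (stage-complete {v = v} (p , u , a , b , p∈ , u∈ , pu , uv , refl) le)

    newBag⇐ : ∀ {v} → v ∈ X ⊎ 2 ≤ stage q (toℕ v) → NewBag X v
    newBag⇐ (inj₁ v∈) = inj₁ v∈
    newBag⇐ (inj₂ 2≤) = let d , d≤r , p , u , a , b , p∈ , u∈ , pu , uv , eq = stage-sound 2≤ in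
      inj₂ (through a b p∈ u∈ pu uv (≤-trans (≤-reflexive eq) d≤r))

  spent≤ : ∀ {e q} → Valid e q → partialSum (weight ∘ vertex q) (size q) ≤ 2 * total
  spent≤ {q = q} v = m+n≤o⇒m≤o (partialSum (weight ∘ vertex q) (size q)) (budget v)

-- The program and its correctness

vN vM vR vT vO vHead vTail vU vG vE vJ vW vH vI : Var
vN = 0; vM = 1; vR = 2; vT = 3; vO = 4; vHead = 5; vTail = 6
vU = 7; vG = 8; vE = 9; vJ = 10; vW = 11; vH = 12; vI = 13

marks outStart outItems outLayer vertices levels depths stages : Arr
marks = 8; outStart = 9; outItems = 10; outLayer = 11
vertices = 12; levels = 13; depths = 14; stages = 15

-- Shared by seeding and scanning. Seeding sets `vG` to 1 and `vE` to 0, as if each member of `P`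
-- were entered from a vertex at stage 1.
visit : Program
visit =
  set vH (sub (lit 2) (sub (sub (lit 2) (var vG)) (read marks (var vW)))) ⨾
  cond (sub (var vH) (read stages (var vW)))
    (write stages (var vW) (var vH) ⨾
     write vertices (var vTail) (var vW) ⨾
     write levels (var vTail) (var vH) ⨾
     write depths (var vTail) (var vE) ⨾
     set vTail (inc (var vTail)))
    skip

scan : Program
scan = forLoop vJ (read 0 (var vU)) (read 0 (inc (var vU)))
  (set vW (read 1 (var vJ)) ⨾ visit)

pop : Program
pop =
  set vU (read vertices (var vHead)) ⨾
  set vG (read levels (var vHead)) ⨾
  set vE (inc (read depths (var vHead))) ⨾
  set vHead (inc (var vHead)) ⨾
  -- Nonzero exactly when `vE` is at most `vR`: entries at depth `r` are popped but not expanded.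
  cond (sub (inc (var vR)) (var vE)) scan skip

search : Program
search = while (sub (var vTail) (var vHead)) pop

clear : Program
clear = forLoop vI (lit 0) (var vN) (write marks (var vI) (lit 0) ⨾ write stages (var vI) (lit 0))

markBag : Program
markBag = forLoop vJ (read 5 (var vT)) (read 5 (inc (var vT))) (write marks (read 6 (var vJ)) (lit 1))

startSearch : Program
startSearch =
  set vHead (lit 0) ⨾ set vTail (lit 0) ⨾ set vG (lit 1) ⨾ set vE (lit 0) ⨾
  forLoop vW (lit 0) (var vN) (cond (read 2 (var vW)) visit skip)

emit : Program
emit = forLoop vI (lit 0) (var vN)
  -- Truncated subtraction encodes the disjunction: for a mark in {0, 1} the value is nonzero if and
  -- only if the mark is 1 or the stage is at least 2.
  (cond (sub (lit 1) (sub (sub (lit 1) (read marks (var vI))) (sub (read stages (var vI)) (lit 1))))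
    (write outItems (var vO) (var vI) ⨾ set vO (inc (var vO)))
    skip)

processBag : Program
processBag = clear ⨾ markBag ⨾ startSearch ⨾ search ⨾ emit ⨾ write outStart (inc (var vT)) (var vO)

assignBlocks : Program
assignBlocks = forLoop vI (lit 0) (var vN)
  (write outLayer (var vI) (quot (quot (read 7 (var vI)) (lit 2)) (var vR)))

program : Program
program =
  assignBlocks ⨾ write outStart (lit 0) (lit 0) ⨾ set vO (lit 0) ⨾
  forLoop vT (lit 0) (var vM) processBag

outputLocation : Location
outputLocation = record
  { treeStart = 3 ; treeItems = 4 ; bagStart = outStart ; bagItems = outItems ; layerOf = outLayer }

-- One row of `Lists` with free end points, so that a row still being written can be described too.
record Segment {n} (items : ℕ → ℕ) (a b : ℕ) (F : Pred (Fin n) 0ℓ) : Set where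
  field
    ordered   : a ≤ b
    sound     : ∀ j → a ≤ j → j < b → ∃ λ v → items j ≡ toℕ v × F v
    complete  : ∀ v → F v → ∃ λ j → a ≤ j × j < b × items j ≡ toℕ v
    no-repeat : ∀ j k → a ≤ j → j < b → a ≤ k → k < b → items j ≡ items k → j ≡ k

lists-segment : ∀ {m n start items} {F : Fin m → Pred (Fin n) 0ℓ} → Lists start items F →
                ∀ i → Segment items (start (toℕ i)) (start (suc (toℕ i))) (F i)
lists-segment L i = record
  { ordered = start-mono i ; sound = sound i ; complete = complete i ; no-repeat = no-repeat i }
  where open Lists L

segments-lists : ∀ {m n start items} {F : Fin m → Pred (Fin n) 0ℓ} → start 0 ≡ 0 →
                 (∀ i → Segment items (start (toℕ i)) (start (suc (toℕ i))) (F i)) →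
                 Lists start items F
segments-lists start0 seg = record
  { start-zero = start0
  ; start-mono = λ i → Segment.ordered (seg i)
  ; sound      = λ i → Segment.sound (seg i)
  ; complete   = λ i → Segment.complete (seg i)
  ; no-repeat  = λ i → Segment.no-repeat (seg i) }

module _ {n} {items : ℕ → ℕ} {a b} {F : Pred (Fin n) 0ℓ} (seg : Segment items a b F) where
  open Segment seg

  segment-resp : ∀ {H : Pred (Fin n) 0ℓ} → (∀ v → F v → H v) → (∀ v → H v → F v) → Segment items a b H
  segment-resp F⇒H H⇒F = record
    { ordered   = ordered
    ; sound     = λ j a≤j j<b → let v , eq , fv = sound j a≤j j<b in v , eq , F⇒H v fv
    ; complete  = λ v hv → complete v (H⇒F v hv)
    ; no-repeat = no-repeat }

  segment-cong : ∀ {items′} → (∀ j → j < b → items′ j ≡ items j) → Segment items′ a b F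
  segment-cong eq = record
    { ordered   = ordered
    ; sound     = λ j a≤j j<b → let v , is , fv = sound j a≤j j<b in v , trans (eq j j<b) is , fv
    ; complete  = λ v fv → let j , a≤j , j<b , is = complete v fv in j , a≤j , j<b , trans (eq j j<b) is
    ; no-repeat = λ j k a≤j j<b a≤k k<b e →
        no-repeat j k a≤j j<b a≤k k<b (trans (sym (eq j j<b)) (trans e (eq k k<b))) }

  segment-snoc : ∀ {v} → ¬ F v → Segment (items [ b ≔ toℕ v ]) a (suc b) (λ u → F u ⊎ u ≡ v)
  segment-snoc {v} v∉ = record
    { ordered = m≤n⇒m≤1+n ordered ; sound = sound⁺ ; complete = complete⁺ ; no-repeat = no-repeat⁺ }
    where
    items⁺ = items [ b ≔ toℕ v ]

    at : items⁺ b ≡ toℕ v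
    at = update-at items b

    old : ∀ {j} → j < b → items⁺ j ≡ items j
    old j<b = update-off items (<⇒≢ j<b)

    sound⁺ : ∀ j → a ≤ j → j < suc b → ∃ λ u → items⁺ j ≡ toℕ u × (F u ⊎ u ≡ v)
    sound⁺ j a≤j j< with m≤n⇒m<n∨m≡n (s≤s⁻¹ j<)
    ... | inj₁ j<b  = let u , is , fu = sound j a≤j j<b in u , trans (old j<b) is , inj₁ fu
    ... | inj₂ refl = v , at , inj₂ refl

    complete⁺ : ∀ u → F u ⊎ u ≡ v → ∃ λ j → a ≤ j × j < suc b × items⁺ j ≡ toℕ u
    complete⁺ u (inj₁ fu) = let j , a≤j , j<b , is = complete u fu in
      j , a≤j , m<n⇒m<1+n j<b , trans (old j<b) is
    complete⁺ u (inj₂ refl) = b , ordered , ≤-refl , at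

    new : ∀ {j} → a ≤ j → j < b → items⁺ j ≢ items⁺ b
    new {j} a≤j j<b eq = let u , is , fu = sound j a≤j j<b in
      v∉ (subst F (Fin.toℕ-injective (trans (sym is) (trans (sym (old j<b)) (trans eq at)))) fu)

    no-repeat⁺ : ∀ j k → a ≤ j → j < suc b → a ≤ k → k < suc b → items⁺ j ≡ items⁺ k → j ≡ k
    no-repeat⁺ j k a≤j j< a≤k k< eq with m≤n⇒m<n∨m≡n (s≤s⁻¹ j<) | m≤n⇒m<n∨m≡n (s≤s⁻¹ k<)
    ... | inj₁ j<b  | inj₁ k<b  =
      no-repeat j k a≤j j<b a≤k k<b (trans (sym (old j<b)) (trans eq (old k<b)))
    ... | inj₁ j<b  | inj₂ refl = contradiction eq (new a≤j j<b)
    ... | inj₂ refl | inj₁ k<b  = contradiction (sym eq) (new a≤k k<b)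
    ... | inj₂ refl | inj₂ refl = refl

  -- Cells map injectively to members. This turns lengths of loops over the input into degrees and
  -- bag sizes.
  segment-length : (F? : Unary.Decidable F) → b ∸ a ≤ ∣ subsetOf F? ∣
  segment-length F? = subst (_≤ ∣ subsetOf F? ∣) (length-tabulate item)
    (unique⇒length≤∣∣ (subsetOf F?) (Unique.tabulate⁺ item-injective)
      (All.tabulate⁺ λ k → ∈-subsetOf⁺ F? (proj₂ (proj₂ (at k)))))
    where
    inside< : ∀ (k : Fin (b ∸ a)) → a + toℕ k < b
    inside< k = ≤-trans (+-monoʳ-< a (Fin.toℕ<n k)) (≤-reflexive (m+[n∸m]≡n ordered))

    at = λ k → sound (a + toℕ k) (m≤m+n a _) (inside< k)

    item : Fin (b ∸ a) → Fin n
    item k = proj₁ (at k)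

    item-injective : ∀ {j k} → item j ≡ item k → j ≡ k
    item-injective {j} {k} eq = Fin.toℕ-injective (+-cancelˡ-≡ a _ _
      (no-repeat _ _ (m≤m+n a _) (inside< j) (m≤m+n a _) (inside< k)
        (trans (proj₁ (proj₂ (at j))) (trans (cong toℕ eq) (sym (proj₁ (proj₂ (at k))))))))

fill : ∀ {Q : ℕ → ℕ → Set} (f : ℕ → ℕ) {i c} → (∀ x → x < i → Q x (f x)) → Q i c →
       ∀ x → x < suc i → Q x ((f [ i ≔ c ]) x)
fill {Q} f {i} old new x x< with m≤n⇒m<n∨m≡n (s≤s⁻¹ x<)
... | inj₁ x<i  = subst (Q x) (sym (update-off f (<⇒≢ x<i))) (old x x<i)
... | inj₂ refl = subst (Q x) (sym (update-at f x)) new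

sum-affine : ∀ {n} a b (f : Fin n → ℕ) → sum (λ v → a + f v * b) ≡ n * a + sum f * b
sum-affine {zero}  a b f = refl
sum-affine {suc n} a b f = trans (cong (a + f zero * b +_) (sum-affine a b (f ∘ suc)))
  (regroup a (f zero) b (n * a) (sum (f ∘ suc)))
  where
  regroup : ∀ a x b y z → a + x * b + (y + z * b) ≡ a + y + (x + z) * b
  regroup = solve-∀

-- The ranges 3 and 8 are the variables and arrays of `Input`. For a concrete program the type
-- evaluates to the unit type, so the hidden argument of `env-frame` is found by unification.
PreservesInput : Program → Set
PreservesInput c = True
  (Fin.all? {3} (λ x → mutatesVar c (toℕ x) Bool.≟ false) ×-dec
   Fin.all? {8} (λ a → mutatesArr c (toℕ a) Bool.≟ false))

-- Correctness and running time on a fixed input.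

module Verification {n m} {G : Graph n} {P : Subset n} {r} .{{_ : NonZero r}}
  {𝒯 : TreeDecomposition G m} {𝓛 : Layering G} (s₀ : Memory) (input : Input s₀ G P r 𝒯 𝓛) where

  open Construction G P r
  open Queue

  -- Indexed by values instead of a memory: assignments to other cells leave these indices
  -- definitionally unchanged, so an `Env s` serves unaltered for the updated memory.
  record SameInput (x₀ x₁ x₂ : ℕ) (a₀ a₁ a₂ a₃ a₄ a₅ a₆ a₇ : ℕ → ℕ) : Set where
    constructor sameInput
    field
      n≡ : x₀ ≡ vars s₀ 0
      m≡ : x₁ ≡ vars s₀ 1
      r≡ : x₂ ≡ vars s₀ 2
      graphStart≡ : a₀ ≡ arrs s₀ 0
      graphItems≡ : a₁ ≡ arrs s₀ 1
      members≡    : a₂ ≡ arrs s₀ 2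
      treeStart≡  : a₃ ≡ arrs s₀ 3
      treeItems≡  : a₄ ≡ arrs s₀ 4
      bagStart≡   : a₅ ≡ arrs s₀ 5
      bagItems≡   : a₆ ≡ arrs s₀ 6
      layerOf≡    : a₇ ≡ arrs s₀ 7

  open SameInput

  Env : Memory → Set
  Env s = SameInput (vars s 0) (vars s 1) (vars s 2) (arrs s 0) (arrs s 1) (arrs s 2) (arrs s 3)
                    (arrs s 4) (arrs s 5) (arrs s 6) (arrs s 7)

  env₀ : Env s₀
  env₀ = sameInput refl refl refl refl refl refl refl refl refl refl refl

  env-frame : ∀ {c s s′} {_ : PreservesInput c} → Frame c s s′ → Env s → Env s′
  env-frame {c} {s} {s′} {safe} fr (sameInput a b d e f g h i j k l) = sameInput
    (trans (var≡ 0F) a) (trans (var≡ 1F) b) (trans (var≡ 2F) d)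
    (trans (arr≡ 0F) e) (trans (arr≡ 1F) f) (trans (arr≡ 2F) g) (trans (arr≡ 3F) h)
    (trans (arr≡ 4F) i) (trans (arr≡ 5F) j) (trans (arr≡ 6F) k) (trans (arr≡ 7F) l)
    where
    var≡ : (x : Fin 3) → vars s′ (toℕ x) ≡ vars s (toℕ x)
    var≡ x = Frame.same-var fr (toℕ x) (proj₁ (toWitness safe) x)
    arr≡ : (x : Fin 8) → arrs s′ (toℕ x) ≡ arrs s (toℕ x)
    arr≡ x = Frame.same-arr fr (toℕ x) (proj₂ (toWitness safe) x)

  gStart gItems : ℕ → ℕ
  gStart = arrs s₀ 0
  gItems = arrs s₀ 1

  neighbour-segment : ∀ u → Segment gItems (gStart (toℕ u)) (gStart (suc (toℕ u))) (Adj G u)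
  neighbour-segment = lists-segment (Input.graph input)

  bag-segment : ∀ t → Segment (arrs s₀ 6) (arrs s₀ 5 (toℕ t)) (arrs s₀ 5 (suc (toℕ t))) (_∈ bag 𝒯 t)
  bag-segment = lists-segment (Stores.bag-lists (Input.decomposition input))

  env-n : ∀ {x₀ x₁ x₂ a₀ a₁ a₂ a₃ a₄ a₅ a₆ a₇} →
          SameInput x₀ x₁ x₂ a₀ a₁ a₂ a₃ a₄ a₅ a₆ a₇ → x₀ ≡ n
  env-n env = trans (n≡ env) (Input.vertices input)

  -- The number of steps taken by an iteration of search that pops the vertex x.
  weight : ℕ → ℕ
  weight x = 8 + (gStart (suc x) ∸ gStart x) * 10

  queueOf : Memory → Queue
  queueOf s = queue (arrs s stages) (arrs s vertices) (arrs s levels) (arrs s depths) (vars s vTail)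

  module _ (t : Fin m) where

    X = bag 𝒯 t

    open Search G P X r weight

    Marks : Memory → Set
    Marks s = ∀ v → arrs s marks (toℕ v) ≡ mark v

    marks-same : ∀ {f g : ℕ → ℕ} → g ≡ f → (∀ v → f (toℕ v) ≡ mark v) → ∀ v → g (toℕ v) ≡ mark v
    marks-same eq mk v = trans (cong (λ f → f (toℕ v)) eq) (mk v)

    visit-spec : ∀ {s e w} → Marks s → vars s vE ≡ e → vars s vW ≡ toℕ w → e ≤ r →
      Valid e (queueOf s) → Trail e w (stageAfter (vars s vG) (mark w)) →
      Runs visit s 7 (λ s′ → Valid e (queueOf s′) × Extends e (queueOf s) (queueOf s′) ×
        Covered (queueOf s′) w (stageAfter (vars s vG) (mark w)) e)
    visit-spec {s} {e} {w} mk refl w≡ e≤r valid trail = set-then (cond-rule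
      (λ ne → write-then (write-then (write-then (write-then (set-rule
        (subst (λ q → Valid e q × Extends e (queueOf s) q × Covered q w h e)
          (cong₂ (λ x y → push x y e (queueOf s)) (sym w≡) (sym h≡))
          (valid-push valid e≤r trail (subst₂ _<_ (cong (arrs s stages) w≡) h≡ (m∸n≢0⇒n<m ne)) ,
           extends-push valid e≤r trail ,
           covered-push valid e≤r trail)))))))
      (λ eq → weaken (s≤s z≤n) (λ z → z) (skip-rule
        (valid , extends-refl , covered-already valid e≤r trail
          (subst₂ _≤_ h≡ (cong (arrs s stages) w≡) (m∸n≡0⇒m≤n eq))))))
      where
      h = stageAfter (vars s vG) (mark w)
      h≡ : stageAfter (vars s vG) (arrs s marks (vars s vW)) ≡ h
      h≡ = cong (stageAfter (vars s vG)) (trans (cong (arrs s marks) w≡) (mk w))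

    scan-spec : ∀ {s e u} → Env s → Marks s → vars s vE ≡ suc e → vars s vU ≡ toℕ u → suc e ≤ r →
      Valid (suc e) (queueOf s) → Trail e u (vars s vG) →
      Runs scan s (2 + (gStart (suc (toℕ u)) ∸ gStart (toℕ u)) * 10)
        (λ s′ → Valid (suc e) (queueOf s′) × Extends (suc e) (queueOf s) (queueOf s′) ×
          (∀ w → Adj G u w → Covered (queueOf s′) w (stageAfter (vars s vG) (mark w)) (suc e)))
    scan-spec {s} {e} {u} env mk e≡ u≡ e≤r valid trail = weaken ≤-refl
      (λ (v , x , cov) → v , x , λ w uw → let j , a≤j , j<b , j≡ = Segment.complete seg w uw in
        cov j a≤j j<b w j≡)
      (for-rule a b 8 I refl (Segment.ordered seg)
        (cong₂ (λ f x → f x) (graphStart≡ env) u≡)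
        (λ fr → cong₂ (λ f x → f (suc x)) (graphStart≡ (env-frame fr env))
                  (trans (Frame.same-var fr vU refl) u≡))
        (valid , extends-refl , λ j a≤j j<a → contradiction j<a (≤⇒≯ a≤j))
        step-spec)
      where
      seg = neighbour-segment u
      a = gStart (toℕ u)
      b = gStart (suc (toℕ u))

      I : ℕ → Memory → Set
      I i s′ = Valid (suc e) (queueOf s′) × Extends (suc e) (queueOf s) (queueOf s′) ×
        (∀ j → a ≤ j → j < i → ∀ w → gItems j ≡ toℕ w →
          Covered (queueOf s′) w (stageAfter (vars s vG) (mark w)) (suc e))

      step-spec : ∀ {i s′} → Frame scan s s′ → a ≤ i → i < b → vars s′ vJ ≡ i → I i s′ →
        Runs (set vW (read 1 (var vJ)) ⨾ visit) s′ 8 (λ s″ → I (suc i) (setVar vJ (suc i) s″))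
      step-spec {i} {s′} fr a≤i i<b j≡ (valid′ , ext , cov) =
        let w , i≡w , uw = Segment.sound seg i a≤i i<b
            g≡ = Frame.same-var fr vG refl
        in set-then (weaken ≤-refl
          (λ {s″} (valid″ , ext′ , cov′) → valid″ , extends-trans ext ext′ , extendCovered ext′ i≡w
            (subst (λ g → Covered (queueOf s″) w (stageAfter g (mark w)) (suc e)) g≡ cov′))
          (visit-spec {w = w} (marks-same (Frame.same-arr fr marks refl) mk)
            (trans (Frame.same-var fr vE refl) e≡)
            (trans (cong₂ (λ f x → f x) (graphItems≡ (env-frame fr env)) j≡) i≡w)
            e≤r valid′
            (subst (λ g → Trail (suc e) w (stageAfter g (mark w))) (sym g≡) (step trail uw))))
        where
        extendCovered : ∀ {q w} → Extends (suc e) (queueOf s′) q → gItems i ≡ toℕ w →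
          Covered q w (stageAfter (vars s vG) (mark w)) (suc e) →
          ∀ j → a ≤ j → j < suc i → ∀ x → gItems j ≡ toℕ x →
          Covered q x (stageAfter (vars s vG) (mark x)) (suc e)
        extendCovered {q} ext′ i≡w cov′ j a≤j j< x j≡x with m≤n⇒m<n∨m≡n (s≤s⁻¹ j<)
        ... | inj₁ j<i  = covered-extends {v = x} ext′ (cov j a≤j j<i x j≡x)
        ... | inj₂ refl = subst (λ x → Covered q x (stageAfter (vars s vG) (mark x)) (suc e))
                            (Fin.toℕ-injective (trans (sym i≡w) j≡x)) cov′

    -- The potential of the search: the budget minus the weights of all popped entries. `spent≤`
    -- ensures that the subtraction does not truncate.
    remaining : Memory → ℕ
    remaining s = 2 * total ∸ partialSum (weight ∘ vertex (queueOf s)) (vars s vHead)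

    SearchInv : ℕ → Memory → Set
    SearchInv φ s = Env s × Marks s × Progress (vars s vHead) (queueOf s) × φ ≡ remaining s

    pop-spec : ∀ {φ s} → SearchInv φ s → vars s vTail ∸ vars s vHead ≢ 0 →
      ∃ λ t → Runs pop s t (λ s′ → ∃ λ φ′ → suc t + φ′ ≤ φ × SearchInv φ′ s′)
    pop-spec {φ} {s} (env , mk , pr , refl) ne =
      -- Four assignments, a test and the two fixed steps of the loop; the test of `search` turns 7
      -- into the 8 of `weight`. A round costs 10: two for the loop, one for reading the neighbour,
      -- seven for `visit`.
      7 + deg * 10 ,
      set-then (set-then (set-then (set-then (cond-rule scans skips))))
      where
      open Progress pr
      q = queueOf s
      H = vars s vHead
      H<T : H < vars s vTail
      H<T = m∸n≢0⇒n<m ne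
      x = vertex q H
      e = depth q H
      deg = gStart (suc x) ∸ gStart x
      u = proj₁ (Valid.entry valid H H<T)
      x≡u : x ≡ toℕ u
      x≡u = proj₁ (proj₂ (Valid.entry valid H H<T))
      trail : Trail e u (level q H)
      trail = proj₁ (proj₂ (proj₂ (Valid.entry valid H H<T)))
      s₄ = setVar vHead (suc H) (setVar vE (suc e) (setVar vG (level q H) (setVar vU x s)))
      valid₄ : Valid (suc e) q
      valid₄ = valid-weaken (λ j j< → lag H ≤-refl H<T j j<) valid

      done : ∀ {s′} → Env s′ → Marks s′ → vars s′ vHead ≡ suc H →
        Valid (suc e) (queueOf s′) → Extends (suc e) q (queueOf s′) →
        (suc e ≤ r → ∀ w → Adj G u w → Covered (queueOf s′) w (stageAfter (level q H) (mark w)) (suc e)) →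
        ∃ λ φ′ → suc (7 + deg * 10) + φ′ ≤ remaining s × SearchInv φ′ s′
      done {s′} env′ mk′ head≡ valid′ ext cov =
        remaining s′ , paid , env′ , mk′ ,
        subst (λ h → Progress h q′) (sym head≡)
          (progress-step pr H<T valid′ ext (λ le v x≡v w vw →
            cov le w (subst (λ v → Adj G v w) (Fin.toℕ-injective (trans (sym x≡v) x≡u)) vw))) ,
        refl
        where
        q′ = queueOf s′
        S = partialSum (weight ∘ vertex q)
        S′ = partialSum (weight ∘ vertex q′)
        S′≡ : S′ (suc H) ≡ S H + weight x
        S′≡ = cong₂ _+_
          (partialSum-cong H (λ i i<H → cong weight (Extends.vertex≡ ext i (<-trans i<H H<T))))
          (cong weight (Extends.vertex≡ ext H H<T))
        S′≤ : S H + weight x ≤ 2 * total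
        S′≤ = ≤-trans (≤-reflexive (sym S′≡)) (≤-trans
          (partialSum-mono _ (≤-trans H<T (Extends.grows ext))) (spent≤ valid′))
        paid : weight x + remaining s′ ≤ remaining s
        paid = ≤-reflexive (begin
          weight x + (2 * total ∸ S′ (vars s′ vHead))
            ≡⟨ cong (λ h → weight x + (2 * total ∸ S′ h)) head≡ ⟩
          weight x + (2 * total ∸ S′ (suc H))     ≡⟨ cong (λ z → weight x + (2 * total ∸ z)) S′≡ ⟩
          weight x + (2 * total ∸ (S H + weight x)) ≡⟨ cong (weight x +_) (∸-+-assoc (2 * total) (S H) (weight x)) ⟨
          weight x + ((2 * total ∸ S H) ∸ weight x)
            ≡⟨ m+[n∸m]≡n (m+n≤o⇒m≤o∸n (weight x) (≤-trans (≤-reflexive (+-comm (weight x) (S H))) S′≤)) ⟩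
          2 * total ∸ S H                         ∎)
          where open ≡-Reasoning

      r≡r : vars s vR ≡ r
      r≡r = trans (r≡ env) (Input.radius input)

      scans : suc (vars s vR) ∸ suc e ≢ 0 → Runs scan s₄ (2 + deg * 10)
        (λ s′ → ∃ λ φ′ → suc (7 + deg * 10) + φ′ ≤ remaining s × SearchInv φ′ s′)
      scans ne = weaken
        (≤-reflexive (cong (λ y → 2 + (gStart (suc y) ∸ gStart y) * 10) (sym x≡u)))
        (λ {s′} (fr , v′ , ext , cov) → done {s′} (env-frame fr env) (marks-same (Frame.same-arr fr marks refl) mk)
          (Frame.same-var fr vHead refl) v′ ext (λ _ → cov))
        (framed (scan-spec {s₄} {e} {u} env mk refl x≡u
          (subst (suc e ≤_) r≡r (s≤s⁻¹ (m∸n≢0⇒n<m ne))) valid₄ trail))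

      skips : suc (vars s vR) ∸ suc e ≡ 0 → Runs skip s₄ (2 + deg * 10)
        (λ s′ → ∃ λ φ′ → suc (7 + deg * 10) + φ′ ≤ remaining s × SearchInv φ′ s′)
      skips eq = weaken (s≤s z≤n) (λ z → z) (skip-rule (done {s₄} env mk refl valid₄ extends-refl
        (λ le → contradiction (subst (suc e ≤_) (sym r≡r) le) (<⇒≱ (m∸n≡0⇒m≤n eq)))))

    search-spec : ∀ {s} → Env s → Marks s → vars s vHead ≡ 0 → Progress 0 (queueOf s) →
      Runs search s (suc (2 * total)) (λ s′ → Env s′ × Marks s′ ×
        ∀ v → (NewBag X v → v ∈ X ⊎ 2 ≤ arrs s′ stages (toℕ v)) ×
              (v ∈ X ⊎ 2 ≤ arrs s′ stages (toℕ v) → NewBag X v))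
    search-spec {s} env mk head≡ pr = weaken
      (s≤s (m∸n≤m (2 * total) (partialSum (weight ∘ vertex (queueOf s)) (vars s vHead))))
      (λ ((_ , env′ , mk′ , pr′ , _) , eq) → env′ , mk′ , λ v →
        newBag⇒ pr′ (m∸n≡0⇒m≤n eq) {v} , newBag⇐ pr′ (m∸n≡0⇒m≤n eq) {v})
      (while-rule SearchInv (λ {φ} {s} → pop-spec {φ} {s})
        (env , mk , subst (λ h → Progress h (queueOf s)) (sym head≡) pr , refl))

    clear-spec : ∀ {s} → Env s → Runs clear s (2 + n * 4)
      (λ s′ → ∀ (v : Fin n) → arrs s′ marks (toℕ v) ≡ 0 × arrs s′ stages (toℕ v) ≡ 0)
    clear-spec {s} env = weaken ≤-refl (λ inv v → proj₁ inv _ (Fin.toℕ<n v) , proj₂ inv _ (Fin.toℕ<n v))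
      (for-rule 0 n 2
        (λ i s′ → (∀ x → x < i → arrs s′ marks x ≡ 0) × (∀ x → x < i → arrs s′ stages x ≡ 0))
        refl z≤n refl (λ fr → env-n (env-frame fr env)) ((λ _ ()) , λ _ ())
        (λ { {s = s′} _ _ _ refl (mk0 , st0) → write-then (write-rule
          (fill {λ _ y → y ≡ 0} (arrs s′ marks) mk0 refl ,
           fill {λ _ y → y ≡ 0} (arrs s′ stages) st0 refl)) }))

    markBag-spec : ∀ {s} → Env s → vars s vT ≡ toℕ t → (∀ (v : Fin n) → arrs s marks (toℕ v) ≡ 0) →
      Runs markBag s (2 + n * 3) Marks
    markBag-spec {s} env t≡ mk0 = weaken
      (+-monoʳ-≤ 2 (*-monoˡ-≤ 3 (≤-trans (segment-length seg (_∈? X)) (∣p∣≤n (subsetOf (_∈? X))))))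
      (λ {s′} → marked {s′})
      (for-rule a b 1 I refl (Segment.ordered seg)
        (cong₂ (λ f x → f x) (bagStart≡ env) t≡)
        (λ fr → cong₂ (λ f x → f (suc x)) (bagStart≡ (env-frame fr env))
                  (trans (Frame.same-var fr vT refl) t≡))
        (λ v → inj₁ (mk0 v , λ j a≤j j<a → contradiction j<a (≤⇒≯ a≤j)))
        (λ {i} {s′} fr a≤i i<b j≡ inv → write-rule (marking {i} {s′} fr a≤i i<b j≡ inv)))
      where
      seg = bag-segment t
      a = arrs s₀ 5 (toℕ t)
      b = arrs s₀ 5 (suc (toℕ t))

      -- The first alternative also remembers that `v` has not been listed so far; at the end,
      -- completeness of the list refutes it for members of the bag.
      I : ℕ → Memory → Set
      I i s′ = ∀ v → (arrs s′ marks (toℕ v) ≡ 0 × ∀ j → a ≤ j → j < i → arrs s₀ 6 j ≢ toℕ v) ⊎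
                     (arrs s′ marks (toℕ v) ≡ 1 × v ∈ X)

      marked : ∀ {s′} → I b s′ → Marks s′
      marked inv v with inv v | v ∈? X
      ... | inj₁ (eq , _)   | no _    = eq
      ... | inj₂ (eq , _)   | yes _   = eq
      ... | inj₂ (_ , v∈)   | no v∉   = contradiction v∈ v∉
      ... | inj₁ (_ , none) | yes v∈  = let j , a≤j , j<b , j≡ = Segment.complete seg v v∈ in
        contradiction j≡ (none j a≤j j<b)

      marking : ∀ {i s′} → Frame markBag s s′ → a ≤ i → i < b → vars s′ vJ ≡ i → I i s′ →
        I (suc i) (writeArr marks (arrs s′ 6 (vars s′ vJ)) 1 s′)
      marking {i} {s′} fr a≤i i<b j≡ inv v with Segment.sound seg i a≤i i<b
      ... | w , i≡w , w∈
        rewrite trans (cong₂ (λ f x → f x) (bagItems≡ (env-frame fr env)) j≡) i≡w with v Fin.≟ w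
      ... | yes refl = inj₂ (update-at (arrs s′ marks) (toℕ v) , w∈)
      ... | no  v≢w with inv v
      ...   | inj₂ (eq , v∈) = inj₂ (trans (update-off (arrs s′ marks) (v≢w ∘ Fin.toℕ-injective)) eq , v∈)
      ...   | inj₁ (eq , none) =
        inj₁ (trans (update-off (arrs s′ marks) (v≢w ∘ Fin.toℕ-injective)) eq , none′)
        where
        none′ : ∀ j → a ≤ j → j < suc i → arrs s₀ 6 j ≢ toℕ v
        none′ j a≤j j< eq′ with m≤n⇒m<n∨m≡n (s≤s⁻¹ j<)
        ... | inj₁ j<i  = none j a≤j j<i eq′
        ... | inj₂ refl = v≢w (Fin.toℕ-injective (trans (sym eq′) i≡w))

    startSearch-spec : ∀ {s} → Env s → Marks s → (∀ (v : Fin n) → arrs s stages (toℕ v) ≡ 0) →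
      Runs startSearch s (6 + n * 10) (λ s′ → vars s′ vHead ≡ 0 × Progress 0 (queueOf s′))
    startSearch-spec {s} env mk st0 = set-then (set-then (set-then (set-then (weaken ≤-refl
      (λ (fr , valid , cov) → Frame.same-var fr vHead refl ,
        progress-start valid (λ p p∈ → cov p p∈ (Fin.toℕ<n p)))
      (framed (for-rule {s₀ = s₄} 0 n 8 I refl z≤n refl (λ fr → env-n (env-frame {s = s₄} fr env))
        (valid-empty refl st0 , λ _ _ ()) step-spec))))))
      where
      s₄ = setVar vE 0 (setVar vG 1 (setVar vTail 0 (setVar vHead 0 s)))
      loop = forLoop vW (lit 0) (var vN) (cond (read 2 (var vW)) visit skip)

      I : ℕ → Memory → Set
      I i s′ = Valid 0 (queueOf s′) ×
        (∀ p → p ∈ P → toℕ p < i → Covered (queueOf s′) p (stageAfter 1 (mark p)) 0)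

      step-spec : ∀ {i s′} → Frame loop s₄ s′ → 0 ≤ i → i < n → vars s′ vW ≡ i → I i s′ →
        Runs (cond (read 2 (var vW)) visit skip) s′ 8 (λ s″ → I (suc i) (setVar vW (suc i) s″))
      step-spec {i} {s′} fr _ i<n w≡ (valid , cov) = cond-rule member nonmember
        where
        w = Fin.fromℕ< i<n
        w≡i : toℕ w ≡ i
        w≡i = Fin.toℕ-fromℕ< i<n
        g≡ : vars s′ vG ≡ 1
        g≡ = Frame.same-var fr vG refl
        member-cell : arrs s′ 2 (vars s′ vW) ≡ arrs s₀ 2 (toℕ w)
        member-cell = cong₂ (λ f x → f x) (members≡ (env-frame {s = s₄} fr env)) (trans w≡ (sym w≡i))

        split : ∀ {p} → toℕ p < suc i → toℕ p < i ⊎ p ≡ w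
        split p< with m≤n⇒m<n∨m≡n (s≤s⁻¹ p<)
        ... | inj₁ p<i = inj₁ p<i
        ... | inj₂ p≡i = inj₂ (Fin.toℕ-injective (trans p≡i (sym w≡i)))

        member : arrs s′ 2 (vars s′ vW) ≢ 0 → Runs visit s′ 7 (λ s″ → I (suc i) (setVar vW (suc i) s″))
        member ne with w ∈? P
        ... | no w∉ = contradiction (trans member-cell (Input.nonmembers input w w∉)) ne
        ... | yes w∈ = weaken ≤-refl
          (λ {s″} (valid′ , ext , cov′) → valid′ , λ p p∈ p< → covers′ ext
            (subst (λ g → Covered (queueOf s″) w (stageAfter g (mark w)) 0) g≡ cov′) p p∈ (split p<))
          (visit-spec {w = w} (marks-same (Frame.same-arr fr marks refl) mk) (Frame.same-var fr vE refl)
            (trans w≡ (sym w≡i)) z≤n valid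
            (subst (λ g → Trail 0 w (stageAfter g (mark w))) (sym g≡) (source w∈)))
          where
          covers′ : ∀ {q} → Extends 0 (queueOf s′) q → Covered q w (stageAfter 1 (mark w)) 0 →
            ∀ p → p ∈ P → toℕ p < i ⊎ p ≡ w → Covered q p (stageAfter 1 (mark p)) 0
          covers′ ext _    p p∈ (inj₁ p<i) = covered-extends {v = p} ext (cov p p∈ p<i)
          covers′ _   cov′ p p∈ (inj₂ refl) = cov′

        nonmember : arrs s′ 2 (vars s′ vW) ≡ 0 →
                    Runs skip s′ 7 (λ s″ → I (suc i) (setVar vW (suc i) s″))
        nonmember eq = weaken (s≤s z≤n) (λ z → z) (skip-rule (valid , λ p p∈ p< → old p p∈ (split p<)))
          where
          old : ∀ p → p ∈ P → toℕ p < i ⊎ p ≡ w → Covered (queueOf s′) p (stageAfter 1 (mark p)) 0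
          old p p∈ (inj₁ p<i) = cov p p∈ p<i
          old p p∈ (inj₂ refl) =
            contradiction (trans (sym (Input.members input w p∈)) (trans (sym member-cell) eq)) λ ()

    selected : ℕ → ℕ → ℕ
    selected mk st = 1 ∸ ((1 ∸ mk) ∸ (st ∸ 1))

    selected⁺ : ∀ v st → v ∈ X ⊎ 2 ≤ st → selected (mark v) st ≢ 0
    selected⁺ v st h eq with v ∈? X
    selected⁺ v st h eq | yes _ rewrite 0∸n≡0 (st ∸ 1) = contradiction eq λ ()
    selected⁺ v st (inj₁ v∈) eq | no v∉ = v∉ v∈
    selected⁺ v (suc (suc st)) (inj₂ _) eq | no _ rewrite 0∸n≡0 st = contradiction eq λ ()
    selected⁺ v (suc zero) (inj₂ (s≤s ())) eq | no _

    selected⁻ : ∀ v st → selected (mark v) st ≢ 0 → v ∈ X ⊎ 2 ≤ st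
    selected⁻ v st ne with v ∈? X
    ... | yes v∈ = inj₁ v∈
    selected⁻ v zero ne | no _ = contradiction refl ne
    selected⁻ v (suc zero) ne | no _ = contradiction refl ne
    selected⁻ v (suc (suc st)) ne | no _ = inj₂ (s≤s (s≤s z≤n))

    -- All new bags share the array `outItems`; the second component protects the rows of earlier
    -- nodes.
    Emitted : Memory → ℕ → Memory → Set
    Emitted s i s′ =
      Segment (arrs s′ outItems) (vars s vO) (vars s′ vO) (λ v → v ∈ newBag 𝒯 t × toℕ v < i) ×
      (∀ j → j < vars s vO → arrs s′ outItems j ≡ arrs s outItems j)

    emit-spec : ∀ {s} → Env s → Marks s →
      (∀ v → (NewBag X v → v ∈ X ⊎ 2 ≤ arrs s stages (toℕ v)) ×
             (v ∈ X ⊎ 2 ≤ arrs s stages (toℕ v) → NewBag X v)) →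
      Runs emit s (2 + n * 5) (Emitted s n)
    emit-spec {s} env mk new = for-rule 0 n 3 (Emitted s) refl z≤n refl (λ fr → env-n (env-frame fr env))
      (record { ordered   = ≤-refl
              ; sound     = λ j o≤j j<o → contradiction j<o (≤⇒≯ o≤j)
              ; complete  = λ _ ()
              ; no-repeat = λ j _ o≤j j<o → contradiction j<o (≤⇒≯ o≤j) } ,
       λ _ _ → refl)
      step-spec
      where
      test = sub (lit 1) (sub (sub (lit 1) (read marks (var vI))) (sub (read stages (var vI)) (lit 1)))
      body = cond test (write outItems (var vO) (var vI) ⨾ set vO (inc (var vO))) skip

      step-spec : ∀ {i s′} → Frame emit s s′ → 0 ≤ i → i < n → vars s′ vI ≡ i → Emitted s i s′ →
        Runs body s′ 3 (λ s″ → Emitted s (suc i) (setVar vI (suc i) s″))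
      step-spec {i} {s′} fr _ i<n refl (seg , same) = cond-rule
        (λ ne → write-then (set-rule
          (subst (λ z → Segment (arrs s′ outItems [ vars s′ vO ≔ z ]) (vars s vO) (suc (vars s′ vO))
                           (λ v → v ∈ newBag 𝒯 t × toℕ v < suc (vars s′ vI))) w≡
            (segment-resp (segment-snoc seg {w} λ (_ , w<) → <-irrefl w≡ w<)
              (λ { v (inj₁ (v∈ , v<)) → v∈ , m<n⇒m<1+n v<
                 ; v (inj₂ refl) → ∈-subsetOf⁺ (newBag? X)
                     (proj₂ (new w) (selected⁻ w (st w) (ne ∘ trans cell≡))) , s≤s (≤-reflexive w≡) })
              (λ v (v∈ , v<) → Sum.map (v∈ ,_) (λ z → z) (split v<))) ,
           λ j j< → trans (update-off (arrs s′ outItems) (<⇒≢ (≤-trans j< (Segment.ordered seg)))) (same j j<))))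
        (λ eq → weaken (s≤s z≤n) (λ z → z) (skip-rule
          (segment-resp seg (λ v (v∈ , v<) → v∈ , m<n⇒m<1+n v<)
             (λ v (v∈ , v<) → v∈ , absent eq v∈ (split v<)) ,
           same)))
        where
        w = Fin.fromℕ< i<n
        w≡ : toℕ w ≡ vars s′ vI
        w≡ = Fin.toℕ-fromℕ< i<n
        st = λ (v : Fin n) → arrs s stages (toℕ v)
        cell≡ : selected (arrs s′ marks (vars s′ vI)) (arrs s′ stages (vars s′ vI)) ≡ selected (mark w) (st w)
        cell≡ = cong₂ selected
          (trans (cong₂ (λ f x → f x) (Frame.same-arr fr marks refl) (sym w≡)) (mk w))
          (cong₂ (λ f x → f x) (Frame.same-arr fr stages refl) (sym w≡))

        split : ∀ {v : Fin n} → toℕ v < suc (vars s′ vI) → toℕ v < vars s′ vI ⊎ v ≡ w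
        split v< with m≤n⇒m<n∨m≡n (s≤s⁻¹ v<)
        ... | inj₁ v<i = inj₁ v<i
        ... | inj₂ v≡i = inj₂ (Fin.toℕ-injective (trans v≡i (sym w≡)))

        absent : selected (arrs s′ marks (vars s′ vI)) (arrs s′ stages (vars s′ vI)) ≡ 0 →
          ∀ {v} → v ∈ newBag 𝒯 t → toℕ v < vars s′ vI ⊎ v ≡ w → toℕ v < vars s′ vI
        absent eq v∈ (inj₁ v<)   = v<
        absent eq v∈ (inj₂ refl) = contradiction (trans (sym cell≡) eq)
          (selected⁺ w (st w) (proj₁ (new w) (∈-subsetOf⁻ (newBag? X) v∈)))

    processBag-spec : ∀ {s} → Env s → vars s vT ≡ toℕ t →
      Runs processBag s (14 + (n * 22 + 2 * total)) (λ s′ →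
        Segment (arrs s′ outItems) (vars s vO) (vars s′ vO) (_∈ newBag 𝒯 t) ×
        (∀ j → j < vars s vO → arrs s′ outItems j ≡ arrs s outItems j) ×
        arrs s′ outStart ≡ arrs s outStart [ suc (toℕ t) ≔ vars s′ vO ])
    processBag-spec {s} env t≡ = weaken (≤-reflexive (regroup n (2 * total))) (λ z → z)
      (seq-rule (clear-spec env) λ fr₁ zeros →
       let env₁ = env-frame fr₁ env in
       seq-rule (markBag-spec env₁ (trans (Frame.same-var fr₁ vT refl) t≡) (proj₁ ∘ zeros)) λ fr₂ mk₂ →
       let env₂ = env-frame fr₂ env₁ in
       seq-rule (startSearch-spec env₂ mk₂ (λ v →
         trans (cong (λ f → f (toℕ v)) (Frame.same-arr fr₂ stages refl)) (proj₂ (zeros v)))) λ fr₃ (head≡ , pr) →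
       seq-rule (search-spec (env-frame fr₃ env₂) (marks-same (Frame.same-arr fr₃ marks refl) mk₂) head≡ pr)
         λ fr₄ (env₄ , mk₄ , new) →
       seq-rule (emit-spec env₄ mk₄ new) λ {s₅} fr₅ (seg , same) →
       let unchanged : ∀ x → mutatesVar clear x ≡ false → mutatesVar markBag x ≡ false →
             mutatesVar startSearch x ≡ false → mutatesVar search x ≡ false → _ ≡ vars s x
           unchanged x p₁ p₂ p₃ p₄ = trans (Frame.same-var fr₄ x p₄) (trans (Frame.same-var fr₃ x p₃)
             (trans (Frame.same-var fr₂ x p₂) (Frame.same-var fr₁ x p₁)))
           unchangedArr : ∀ x → mutatesArr clear x ≡ false → mutatesArr markBag x ≡ false →
             mutatesArr startSearch x ≡ false → mutatesArr search x ≡ false → _ ≡ arrs s x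
           unchangedArr x p₁ p₂ p₃ p₄ = trans (Frame.same-arr fr₄ x p₄) (trans (Frame.same-arr fr₃ x p₃)
             (trans (Frame.same-arr fr₂ x p₂) (Frame.same-arr fr₁ x p₁)))
           o≡ = unchanged vO refl refl refl refl
           items≡ = unchangedArr outItems refl refl refl refl
           start≡ = trans (Frame.same-arr fr₅ outStart refl) (unchangedArr outStart refl refl refl refl)
           T≡ = trans (Frame.same-var fr₅ vT refl) (trans (unchanged vT refl refl refl refl) t≡)
       in write-rule
         (subst (λ o → Segment (arrs s₅ outItems) o (vars s₅ vO) (_∈ newBag 𝒯 t)) o≡
            (segment-resp seg (λ _ → proj₁) (λ v v∈ → v∈ , Fin.toℕ<n v)) ,
          (λ j j<o → trans (same j (subst (j <_) (sym o≡) j<o)) (cong (λ f → f j) items≡)) ,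
          cong₂ (λ f x → f [ suc x ≔ vars s₅ vO ]) start≡ T≡))
      where
      regroup : ∀ n B → (2 + n * 4) + ((2 + n * 3) + ((6 + n * 10) + (suc B + ((2 + n * 5) + 1)))) ≡
                        14 + (n * 22 + B)
      regroup = solve-∀

  total≤ : sum {n} (λ v → weight (toℕ v)) ≤ n * 8 + 2 * ∣E G ∣ * 10
  total≤ = begin
    sum {n} (λ v → weight (toℕ v))
      ≤⟨ sum-mono-≤ (λ v → +-monoʳ-≤ 8 (*-monoˡ-≤ 10 (segment-length (neighbour-segment v) (adj? G v)))) ⟩
    sum (λ v → 8 + ∣ neighbours G v ∣ * 10)     ≡⟨ sum-affine 8 10 (λ v → ∣ neighbours G v ∣) ⟩
    n * 8 + sum (λ v → ∣ neighbours G v ∣) * 10 ≤⟨ +-monoʳ-≤ (n * 8) (*-monoˡ-≤ 10 (handshake G)) ⟩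
    n * 8 + 2 * ∣E G ∣ * 10                     ∎
    where open ≤-Reasoning

  LayersDone : ℕ → Memory → Set
  LayersDone i s = ∀ v → v < i → arrs s outLayer v ≡ block r (arrs s₀ 7 v)

  assignBlocks-spec : Runs assignBlocks s₀ (2 + n * 3) (LayersDone n)
  assignBlocks-spec = for-rule 0 n 1 LayersDone refl z≤n refl
    (λ fr → env-n (env-frame fr env₀)) (λ _ ())
    (λ { {s = s} fr _ _ refl done → write-rule
      (fill {λ v y → y ≡ block r (arrs s₀ 7 v)} (arrs s outLayer) done
        (cong₂ block (trans (r≡ (env-frame fr env₀)) (Input.radius input))
          (cong (λ f → f (vars s vI)) (layerOf≡ (env-frame fr env₀))))) })

  -- Finished rows end no later than the write position `vO`, so later output cannot overwrite them.
  BagsDone : ℕ → Memory → Set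
  BagsDone i s = arrs s outStart 0 ≡ 0 × vars s vO ≡ arrs s outStart i ×
    (∀ t → toℕ t < i → arrs s outStart (suc (toℕ t)) ≤ vars s vO ×
      Segment (arrs s outItems) (arrs s outStart (toℕ t)) (arrs s outStart (suc (toℕ t))) (_∈ newBag 𝒯 t))

  bags-spec : ∀ {s} → Env s → arrs s outStart 0 ≡ 0 → vars s vO ≡ 0 →
    Runs (forLoop vT (lit 0) (var vM) processBag) s
      (2 + m * (16 + (n * 22 + 2 * (n * 8 + 2 * ∣E G ∣ * 10)))) (BagsDone m)
  bags-spec {s} env start0 o≡0 = for-rule 0 m (14 + (n * 22 + 2 * (n * 8 + 2 * ∣E G ∣ * 10)))
    BagsDone refl z≤n refl (λ fr → trans (m≡ (env-frame fr env)) (Input.nodes input))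
    (start0 , trans o≡0 (sym start0) , λ _ ()) step-spec
    where
    step-spec : ∀ {i s′} → Frame (forLoop vT (lit 0) (var vM) processBag) s s′ → 0 ≤ i → i < m →
      vars s′ vT ≡ i → BagsDone i s′ →
      Runs processBag s′ (14 + (n * 22 + 2 * (n * 8 + 2 * ∣E G ∣ * 10)))
        (λ s″ → BagsDone (suc i) (setVar vT (suc i) s″))
    step-spec {i} {s′} fr _ i<m t≡i (st0 , o≡ , bags) = weaken
      (+-monoʳ-≤ 14 (+-monoʳ-≤ (n * 22) (*-monoʳ-≤ 2 total≤)))
      (λ {s″} → finish {s″})
      (processBag-spec t (env-frame fr env) (trans t≡i (sym toℕt≡i)))
      where
      t = Fin.fromℕ< i<m
      toℕt≡i : toℕ t ≡ i
      toℕt≡i = Fin.toℕ-fromℕ< i<m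
      S = arrs s′ outStart

      finish : ∀ {s″} →
        Segment (arrs s″ outItems) (vars s′ vO) (vars s″ vO) (_∈ newBag 𝒯 t) ×
        (∀ j → j < vars s′ vO → arrs s″ outItems j ≡ arrs s′ outItems j) ×
        arrs s″ outStart ≡ S [ suc (toℕ t) ≔ vars s″ vO ] →
        BagsDone (suc i) s″
      finish {s″} (seg , same , start≡) rewrite start≡ | toℕt≡i =
        st0 , sym (update-at S (suc i)) , done
        where
        S⁺ = S [ suc i ≔ vars s″ vO ]

        done : ∀ u → toℕ u < suc i → S⁺ (suc (toℕ u)) ≤ vars s″ vO ×
          Segment (arrs s″ outItems) (S⁺ (toℕ u)) (S⁺ (suc (toℕ u))) (_∈ newBag 𝒯 u)
        done u u< with m≤n⇒m<n∨m≡n (s≤s⁻¹ u<)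
        ... | inj₁ u<i
          rewrite update-off S {suc i} {vars s″ vO} (<⇒≢ (m<n⇒m<1+n u<i))
                | update-off S {suc i} {vars s″ vO} (<⇒≢ (s≤s u<i)) =
          let le , segᵤ = bags u u<i in
          ≤-trans le (Segment.ordered seg) , segment-cong segᵤ (λ j j< → same j (≤-trans j< le))
        ... | inj₂ u≡i with refl ← Fin.toℕ-injective {i = u} {t} (trans u≡i (sym toℕt≡i))
          rewrite u≡i | update-at S (suc i) {vars s″ vO}
                | update-off S {suc i} {vars s″ vO} (<⇒≢ (n<1+n i)) =
          ≤-refl , subst (λ o → Segment (arrs s″ outItems) o (vars s″ vO) (_∈ newBag 𝒯 u)) o≡ seg

  -- Per node the vertices cost 38 each (22 for the loops, 16 for the search) and the edges 40. The
  -- layers cost 3 more per vertex, once, and are charged to the first node, which exists as a tree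
  -- is nonempty: 38 + 3 = 41. The successor in the bound absorbs the constant costs.
  program-time : (2 + n * 3) + suc (suc (2 + m * (16 + (n * 22 + 2 * (n * 8 + 2 * ∣E G ∣ * 10))))) ≤
                 41 * (m * suc (n + ∣E G ∣))
  program-time = go m (IsTree.nonEmpty (isTree 𝒯))
    where
    open ≤-Reasoning
    E = ∣E G ∣
    expand : ∀ k n E → 41 * (suc k * suc (n + E)) ≡
      (2 + n * 3) + suc (suc (2 + suc k * (16 + (n * 22 + 2 * (n * 8 + 2 * E * 10))))) +
      (k * (25 + n * 3 + E) + (19 + E))
    expand = solve-∀
    go : ∀ m → 0 < m → (2 + n * 3) + suc (suc (2 + m * (16 + (n * 22 + 2 * (n * 8 + 2 * E * 10))))) ≤
         41 * (m * suc (n + E))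
    go (suc k) _ = ≤-trans (m≤m+n _ (k * (25 + n * 3 + E) + (19 + E))) (≤-reflexive (sym (expand k n E)))

  program-spec : Runs program s₀
    ((2 + n * 3) + suc (suc (2 + m * (16 + (n * 22 + 2 * (n * 8 + 2 * ∣E G ∣ * 10))))))
    (λ s′ → Stores outputLocation s′ (𝒯′ 𝒯) (𝓛′ 𝓛))
  program-spec = seq-rule assignBlocks-spec λ {s₁} fr₁ layers →
    let env₁ = env-frame {assignBlocks} {s₀} fr₁ env₀
        s₂ = setVar vO 0 (writeArr outStart 0 0 s₁)
    in write-then {e = lit 0} {lit 0} (set-then {e = lit 0} (weaken ≤-refl
      (λ (fr₂ , start0 , _ , bags) →
        let env₂ = env-frame {s = s₂} fr₂ env₁ in record
        { tree-lists  = subst₂ (λ f g → Lists f g (Adj (tree 𝒯)))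
            (sym (treeStart≡ env₂)) (sym (treeItems≡ env₂)) (Stores.tree-lists (Input.decomposition input))
        ; bag-lists   = segments-lists start0 (λ t → proj₂ (bags t (Fin.toℕ<n t)))
        -- The memory stores some layer that contains `v`; uniqueness identifies it with
        -- `index 𝓛 v`.
        ; layer-index = λ v → ∈-subsetOf⁺ (inBlock? 𝓛 _) (sym (trans
            (cong (λ f → f (toℕ v)) (Frame.same-arr fr₂ outLayer refl))
            (trans (layers (toℕ v) (Fin.toℕ<n v))
              (cong (block r) (sym (index-unique 𝓛 (Stores.layer-index (Input.decomposition input) v)))))))
        })
      (framed (bags-spec {s₂} env₁ refl refl))))

  program-computes : ∀ {ℓ} → WitnessLayeredTreeIndependence (𝒯′ 𝒯) (𝓛′ 𝓛) ℓ →
    Computes program outputLocation s₀ (41 * (m * suc (n + ∣E G ∣))) (cliquification G P r) m ℓ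
  program-computes witness =
    𝒯′ 𝒯 , 𝓛′ 𝓛 , witness , final , time , run , ≤-trans within program-time , post
    where open Runs program-spec

theorem3p1 : (Σ Program λ prog → Σ Location λ out → Σ ℕ λ C →
    ∀ {n m : ℕ} (G : Graph n) (P : Subset n) (r : ℕ) → 1 ≤ r →
    (𝒯 : TreeDecomposition G m) (𝓛 : Layering G) (k : ℕ) →
    WitnessLayeredTreewidth 𝒯 𝓛 k →
    (s : Memory) → Input s G P r 𝒯 𝓛 →
    Computes prog out s (C * (m * suc (n + ∣E G ∣)))
    (cliquification G P r) m (4 * r * k))
    ×
    (Σ Program λ prog → Σ Location λ out → Σ ℕ λ C →
    ∀ {n m : ℕ} (G : Graph n) (P : Subset n) → Independent G P →
    (𝒯 : TreeDecomposition G m) (𝓛 : Layering G) (k : ℕ) →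
    WitnessLayeredTreeIndependence 𝒯 𝓛 k →
    (s : Memory) → Input s G P 1 𝒯 𝓛 →
    Computes prog out s (C * (m * suc (n + ∣E G ∣)))
    (cliquification G P 1) m (4 * 1 * k))
theorem3p1 =
  (program , outputLocation , 41 , λ where
    -- Matching on the successor provides the instance `NonZero r`. Both halves run the same
    -- program; only the witness for the bound differs.
    G P r@(suc _) _ 𝒯 𝓛 k w s input →
      Verification.program-computes s input (Construction.treewidth-witness G P r 𝓛 𝒯 w)) ,
  (program , outputLocation , 41 , λ G P ind 𝒯 𝓛 k w s input →
    Verification.program-computes s input (tree-independence-witness ind 𝒯 𝓛 w))
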